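{- Let $p$ be an odd prime, $x\in\mathbb Z_p$ with $(x-1)x(x+1)(x+2)\not\equiv0\pmod p$, and $x'=(x-\langle x\rangle_p)/p$. Then $$\sum_{n=0}^{p-1}nG_n(x)\equiv\begin{cases}p^2\dfrac{x'(x'+1)(1-x(x+1))-x(x+1)}{(x-1)x(x+1)(x+2)}\pmod{p^3}&\text{if }2\mid\langle x\rangle_p,\\[2mm] p^2\dfrac{x'(x'+1)(1-x(x+1))-(x-1)(x+2)}{(x-1)x(x+1)(x+2)}\pmod{p^3}&\text{if }2\nmid\langle x\rangle_p.\end{cases}$$ Consequently, for every prime $p>3$: $$\sum_{n=0}^{p-1}\frac{nG_n}{16^n}\equiv\begin{cases}-\frac19p^2\pmod{p^3}&\text{if }p\equiv1\pmod4,\\ \frac{31}9p^2\pmod{p^3}&\text{if }p\equiv3\pmod4,\end{cases}\qquad \sum_{n=0}^{p-1}\frac{nG_n^{(3)}}{27^n}\equiv\begin{cases}-\frac1{10}p^2\pmod{p^3}&\text{if }p\equiv1\pmod3,\\ \frac{79}{20}p^2\pmod{p^3}&\text{if }p\equiv2\pmod3,\ p\ne5,\end{cases}$$ $$\sum_{n=0}^{p-1}\frac{nG_n^{(4)}}{64^n}\equiv\begin{cases}-\frac3{35}p^2\pmod{p^3}&\text{if }p\equiv1,3\pmod8,\\ \frac{503}{105}p^2\pmod{p^3}&\text{if }p\equiv5,7\pmod8,\ p\ne5,7,\end{cases}\qquad \sum_{n=0}^{p-1}\frac{nG_n^{(6)}}{432^n}\equiv\begin{cases}-\frac5{77}p^2\pmod{p^3}&\text{if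 }p\equiv1\pmod4,\\ \frac{2567}{385}p^2\pmod{p^3}&\text{if }p\equiv3\pmod4,\ p\ne7,11.\end{cases}$$
   Context: For a real number $x$ and an integer $k\ge0$, $\binom xk=x(x-1)\cdots(x-k+1)/k!$. Define $G_n(x)=\sum_{k=0}^n\binom nk(-1)^k\binom xk\binom{ -1-x}k$. For a prime $p$, $\mathbb Z_p$ is the set of rationals whose denominator is not divisible by $p$; congruences modulo powers of $p$ are in $\mathbb Z_p$. For $x\in\mathbb Z_p$, $\langle x\rangle_p\in\{0,\ldots,p-1\}$ satisfies $x\equiv\langle x\rangle_p\pmod p$. Also $G_n=16^nG_n(-\tfrac12)=\sum_{k=0}^n\binom nk(-1)^k\binom{2k}k^216^{n-k}$, $G_n^{(3)}=27^nG_n(-\tfrac13)=\sum_{k=0}^n\binom nk(-1)^k\binom{2k}k\binom{3k}k27^{n-k}$, $G_n^{(4)}=64^nG_n(-\tfrac14)=\sum_{k=0}^n\binom nk(-1)^k\binom{2k}k\binom{4k}{2k}64^{n-k}$, $G_n^{(6)}=432^nG_n(-\tfrac16)=\sum_{k=0}^n\binom nk(-1)^k\binom{3k}k\binom{6k}{3k}432^{n-k}$. -}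

module Defs where

open import Data.Nat as ℕ using (ℕ; zero; suc)
open import Data.Nat.Divisibility using (_∣_)
open import Data.Nat.Combinatorics using (_C_)
open import Data.Integer as ℤ using (ℤ; +_; -[1+_])
open import Data.Rational as ℚ using (ℚ; mkℚ; ↧ₙ_; _+_; _*_; _-_; -_; 0ℚ; 1ℚ)
open import Data.List using (List; map; upTo; foldr)
open import Relation.Nullary using (¬_)

ℕ→ℚ : ℕ → ℚ
ℕ→ℚ n = (+ n) ℚ./ 1

ℤ→ℚ : ℤ → ℚ
ℤ→ℚ z = z ℚ./ 1

-- total division on ℚ (returns 0 when dividing by 0; only ever used with nonzero divisors)
_÷'_ : ℚ → ℚ → ℚ
a ÷' mkℚ (+ zero) _ _ = 0ℚ
a ÷' b@(mkℚ (+ suc _) _ _) = a ℚ.÷ b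
a ÷' b@(mkℚ -[1+ _ ] _ _) = a ℚ.÷ b

sumQ : ℕ → (ℕ → ℚ) → ℚ
sumQ n f = foldr _+_ 0ℚ (map f (upTo n))

sumℤ : ℕ → (ℕ → ℤ) → ℤ
sumℤ n f = foldr ℤ._+_ (+ 0) (map f (upTo n))

fallingQ : ℚ → ℕ → ℚ
fallingQ x zero = 1ℚ
fallingQ x (suc k) = fallingQ x k * (x - ℕ→ℚ k)

factorialQ : ℕ → ℚ
factorialQ zero = 1ℚ
factorialQ (suc k) = factorialQ k * ℕ→ℚ (suc k)

binomQ : ℚ → ℕ → ℚ
binomQ x k = fallingQ x k ÷' factorialQ k

signQ : ℕ → ℚ
signQ zero = 1ℚ
signQ (suc k) = - signQ k

signℤ : ℕ → ℤ
signℤ zero = + 1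
signℤ (suc k) = ℤ.- signℤ k

G : ℕ → ℚ → ℚ
G n x = sumQ (suc n) (λ k → ℕ→ℚ (n C k) * signQ k * binomQ x k * binomQ (- 1ℚ - x) k)

G2 : ℕ → ℤ
G2 n = sumℤ (suc n) (λ k → + (n C k) ℤ.* signℤ k ℤ.* + (((2 ℕ.* k) C k) ℕ.^ 2) ℤ.* + (16 ℕ.^ (n ℕ.∸ k)))

G3 : ℕ → ℤ
G3 n = sumℤ (suc n) (λ k → + (n C k) ℤ.* signℤ k ℤ.* + (((2 ℕ.* k) C k) ℕ.* ((3 ℕ.* k) C k)) ℤ.* + (27 ℕ.^ (n ℕ.∸ k)))

G4 : ℕ → ℤ
G4 n = sumℤ (suc n) (λ k → + (n C k) ℤ.* signℤ k ℤ.* + (((2 ℕ.* k) C k) ℕ.* ((4 ℕ.* k) C (2 ℕ.* k))) ℤ.* + (64 ℕ.^ (n ℕ.∸ k)))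

G6 : ℕ → ℤ
G6 n = sumℤ (suc n) (λ k → + (n C k) ℤ.* signℤ k ℤ.* + (((3 ℕ.* k) C k) ℕ.* ((6 ℕ.* k) C (3 ℕ.* k))) ℤ.* + (432 ℕ.^ (n ℕ.∸ k)))

InZp : ℕ → ℚ → Set
InZp p q = ¬ (p ∣ ↧ₙ q)

CongQ : ℕ → ℕ → ℚ → ℚ → Set
CongQ p m a b = InZp p ((a - b) ÷' ℕ→ℚ (p ℕ.^ m))

infix 7 _//_
_//_ : ℤ → ℕ → ℚ
n // d = ℤ→ℚ n ÷' ℕ→ℚ d

{-# OPTIONS --safe #-}

-- Write a_k = (-1)^k C(x,k) C(-1-x,k), t = x(x+1) and u_n = n² (G_n - G_{n-1}), where G_n = Σ C(n,k) a_k.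
-- From (k+1)² a_{k+1} = (t - k(k+1)) a_k one gets u_{n+1} - u_n = t G_n. Summing this, and summing it by parts against n, yields
--   t Σ_{n<p} G_n = u_p   and   (t - 2) Σ_{n<p} n G_n = p u_p - p² G_p + Σ_{n<p} G_n,
-- hence t (t - 2) Σ_{n<p} n G_n = p² ((1 - t) G_p - G_{p-1} + p t (G_p - G_{p-1})), where t (t - 2) = (x-1) x (x+1) (x+2).
-- Modulo p only the terms k = 0 and k = p of G_p survive, and C(x,p) ≡ x', so G_p ≡ 1 + x'(x'+1);
-- and G_{p-1} ≡ Σ_k C(r,k) C(-1-r,k) = (-1)^r with r = ⟨x⟩_p.
-- The special values are x = -1/m: then p ≡ ±1 mod m (m ∈ {2,3,4,6}) gives r = (a p - 1)/m and x' = -a/m with a = 1 or m - 1.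
module Submission where

open import Defs
open import Data.Nat as ℕ using (ℕ; zero; suc; _<_; _≤_; _%_; _!)
import Data.Nat.Properties as ℕP
open import Data.Nat.Combinatorics using (_C_; nCn≡1; k>n⇒nCk≡0; nCk+nC[k+1]≡[n+1]C[k+1]; k![n∸k]!∣n!)
open import Data.Nat.Combinatorics.Specification using (nCk≡n!/k![n-k]!)
import Data.Nat.Coprimality as Coprimality
open import Data.Nat.Divisibility using (_∣_; _∣?_; ∣-trans; ∣⇒≤; divides)
open import Data.Nat.DivMod using (DivMod; _divMod_; result; m/n*n≡m; m≡m%n+[m/n]*n)
open import Data.Nat.Primality using (Prime; prime?; ¬prime[0]; euclidsLemma; prime⇒nonZero; prime⇒nonTrivial; prime⇒irreducible)
import Data.Nat.Tactic.RingSolver as ℕSolver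
open import Data.Fin using () renaming (zero to fzero; suc to fsuc)
open import Data.Integer as ℤ using (ℤ; +_; -[1+_])
import Data.Integer.Divisibility.Signed as SignedDivisibility
import Data.Integer.Properties as ℤP
open import Data.Rational as ℚ using (ℚ; mkℚ; ↥_; ↧ₙ_; toℚᵘ; _+_; _*_; _-_; -_; 1/_; 0ℚ; 1ℚ)
import Data.Rational.Properties as ℚP
open import Data.Rational.Unnormalised as ℚᵘ using (mkℚᵘ; *≡*)
import Data.Rational.Unnormalised.Properties as ℚᵘP
open import Data.List using ([]; _∷_; _++_; _∷ʳ_; map; upTo; foldr)
open import Data.List.Properties using (applyUpTo-∷ʳ; map-++)
open import Data.Product using (_×_; _,_; ∃-syntax)
open import Data.Sum using (_⊎_; inj₁; inj₂)
open import Function using (id; _∘_)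
open import Level using (0ℓ)
open import Relation.Binary.PropositionalEquality
open import Relation.Nullary using (¬_; Dec; contradiction; yes; no)
open import Relation.Nullary.Decidable using (True; dec⇒maybe; toWitness; toWitnessFalse)
open import Tactic.RingSolver using (solve-∀)
open import Tactic.RingSolver.Core.AlmostCommutativeRing using (AlmostCommutativeRing; fromCommutativeRing)

open ≡-Reasoning

-- The closed formula holds over ℚ for every positive integer p, with the factor p² already
-- explicit. Hence only G_p and G_{p-1} modulo p remain to be found, and the summand p t (G_p -
-- G_{p-1}) has to supply nothing but integrality. The one delicate term is a_p: its factors C(x,p)
-- and C(-1-x,p) each hide a division by p, so modulo p they depend on x modulo p² and not on its
-- residue alone; this is how x' enters. Every a_k with k < p is p-integral and depends modulo p on
-- r only. At x = -1/m one has t = -(m-1)/m², and x'(x'+1) = t as well, both for a = 1 and for a = m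
-- - 1. The coefficient of p² is therefore t/(2 - t) for even r and (2 - t²)/(t (t - 2)) for odd r,
-- and every constant of the theorem is one of these two values. Only the parity of r must be read
-- off from the residue class of p, which is why classes such as 1 and 3 modulo 8 share a value.

ℚ-ring : AlmostCommutativeRing 0ℓ 0ℓ
ℚ-ring = fromCommutativeRing ℚP.+-*-commutativeRing (λ x → dec⇒maybe (0ℚ ℚP.≟ x))

-- Embedding of the integers and total division

toℚᵘ-ℤ→ℚ : ∀ z → toℚᵘ (ℤ→ℚ z) ℚᵘ.≃ mkℚᵘ z 0
toℚᵘ-ℤ→ℚ z = ℚP.toℚᵘ-fromℚᵘ (mkℚᵘ z 0)

ℤ→ℚ-injective : ∀ {a b} → ℤ→ℚ a ≡ ℤ→ℚ b → a ≡ b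
ℤ→ℚ-injective {a} {b} eq with ℚP./-injective-≃ (mkℚᵘ a 0) (mkℚᵘ b 0) eq
... | *≡* e = trans (sym (ℤP.*-identityʳ a)) (trans e (ℤP.*-identityʳ b))

ℤ→ℚ-+ : ∀ a b → ℤ→ℚ (a ℤ.+ b) ≡ ℤ→ℚ a + ℤ→ℚ b
ℤ→ℚ-+ a b = ℚP.toℚᵘ-injective (ℚᵘP.≃-trans (toℚᵘ-ℤ→ℚ (a ℤ.+ b)) (ℚᵘP.≃-sym
  (ℚᵘP.≃-trans (ℚP.toℚᵘ-homo-+ (ℤ→ℚ a) (ℤ→ℚ b))
  (ℚᵘP.≃-trans (ℚᵘP.+-cong (toℚᵘ-ℤ→ℚ a) (toℚᵘ-ℤ→ℚ b))
  (*≡* (cong (ℤ._* + 1) (cong₂ ℤ._+_ (ℤP.*-identityʳ a) (ℤP.*-identityʳ b))))))))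

ℤ→ℚ-* : ∀ a b → ℤ→ℚ (a ℤ.* b) ≡ ℤ→ℚ a * ℤ→ℚ b
ℤ→ℚ-* a b = ℚP.toℚᵘ-injective (ℚᵘP.≃-trans (toℚᵘ-ℤ→ℚ (a ℤ.* b)) (ℚᵘP.≃-sym
  (ℚᵘP.≃-trans (ℚP.toℚᵘ-homo-* (ℤ→ℚ a) (ℤ→ℚ b))
  (ℚᵘP.*-cong (toℚᵘ-ℤ→ℚ a) (toℚᵘ-ℤ→ℚ b)))))

ℤ→ℚ-neg : ∀ a → ℤ→ℚ (ℤ.- a) ≡ - ℤ→ℚ a
ℤ→ℚ-neg a = ℚP.toℚᵘ-injective (ℚᵘP.≃-trans (toℚᵘ-ℤ→ℚ (ℤ.- a)) (ℚᵘP.≃-sym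
  (ℚᵘP.≃-trans (ℚP.toℚᵘ-homo‿- (ℤ→ℚ a)) (ℚᵘP.-‿cong (toℚᵘ-ℤ→ℚ a)))))

ℕ→ℚ-+ : ∀ m n → ℕ→ℚ (m ℕ.+ n) ≡ ℕ→ℚ m + ℕ→ℚ n
ℕ→ℚ-+ m n = ℤ→ℚ-+ (+ m) (+ n)

ℕ→ℚ-* : ∀ m n → ℕ→ℚ (m ℕ.* n) ≡ ℕ→ℚ m * ℕ→ℚ n
ℕ→ℚ-* m n = trans (cong ℤ→ℚ (ℤP.pos-* m n)) (ℤ→ℚ-* (+ m) (+ n))

ℕ→ℚ-suc : ∀ n → ℕ→ℚ (suc n) ≡ ℕ→ℚ n + 1ℚ
ℕ→ℚ-suc n = trans (ℕ→ℚ-+ 1 n) (ℚP.+-comm 1ℚ (ℕ→ℚ n))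

ℕ→ℚ≢0 : ∀ n .{{_ : ℕ.NonZero n}} → ℕ→ℚ n ≢ 0ℚ
ℕ→ℚ≢0 (suc n) eq with ℤ→ℚ-injective {+ suc n} {+ 0} eq
... | ()

private
  swap-inverse : ∀ b a i → b * (a * i) ≡ (i * b) * a
  swap-inverse = solve-∀ ℚ-ring

÷'-cancelˡ : ∀ a {b} → b ≢ 0ℚ → b * (a ÷' b) ≡ a
÷'-cancelˡ a {mkℚ (+ zero) d c} b≢0 with ℚ.≢-nonZero b≢0
... | ()
÷'-cancelˡ a {b@(mkℚ (+ suc _) _ _)} b≢0 =
  trans (swap-inverse b a (1/ b)) (trans (cong (_* a) (ℚP.*-inverseˡ b)) (ℚP.*-identityˡ a))
÷'-cancelˡ a {b@(mkℚ -[1+ _ ] _ _)} b≢0 =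
  trans (swap-inverse b a (1/ b)) (trans (cong (_* a) (ℚP.*-inverseˡ b)) (ℚP.*-identityˡ a))

*-cancelˡ : ∀ {c a b} → c ≢ 0ℚ → c * a ≡ c * b → a ≡ b
*-cancelˡ {c} {a} {b} c≢0 eq = begin
  a                  ≡⟨ lemma a ⟩
  (1ℚ ÷' c) * (c * a) ≡⟨ cong ((1ℚ ÷' c) *_) eq ⟩
  (1ℚ ÷' c) * (c * b) ≡⟨ lemma b ⟨
  b                  ∎
  where
  lemma : ∀ a → a ≡ (1ℚ ÷' c) * (c * a)
  lemma a = begin
    a                   ≡⟨ ℚP.*-identityˡ a ⟨
    1ℚ * a              ≡⟨ cong (_* a) (÷'-cancelˡ 1ℚ c≢0) ⟨
    c * (1ℚ ÷' c) * a   ≡⟨ cong (_* a) (ℚP.*-comm c (1ℚ ÷' c)) ⟩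
    (1ℚ ÷' c) * c * a   ≡⟨ ℚP.*-assoc (1ℚ ÷' c) c a ⟩
    (1ℚ ÷' c) * (c * a) ∎

÷'-unique : ∀ {a b c} → b ≢ 0ℚ → b * c ≡ a → a ÷' b ≡ c
÷'-unique {a} b≢0 eq = *-cancelˡ b≢0 (trans (÷'-cancelˡ a b≢0) (sym eq))

*≢0 : ∀ {a b} → a ≢ 0ℚ → b ≢ 0ℚ → a * b ≢ 0ℚ
*≢0 {a} a≢0 b≢0 eq = b≢0 (*-cancelˡ a≢0 (trans eq (sym (ℚP.*-zeroʳ a))))

unit≢0 : ∀ {a b} → a * b ≡ 1ℚ → a ≢ 0ℚ
unit≢0 {b = b} ab≡1 refl with trans (sym ab≡1) (ℚP.*-zeroˡ b)
... | ()

-- Finite sums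

sumQ-suc : ∀ n f → sumQ (suc n) f ≡ sumQ n f + f n
sumQ-suc n f = begin
  foldr _+_ 0ℚ (map f (upTo (suc n)))         ≡⟨ cong (foldr _+_ 0ℚ ∘ map f) (applyUpTo-∷ʳ id n) ⟨
  foldr _+_ 0ℚ (map f (upTo n ∷ʳ n))          ≡⟨ cong (foldr _+_ 0ℚ) (map-++ f (upTo n) (n ∷ [])) ⟩
  foldr _+_ 0ℚ (map f (upTo n) ++ (f n ∷ [])) ≡⟨ snoc (map f (upTo n)) ⟩
  foldr _+_ 0ℚ (map f (upTo n)) + f n         ∎
  where
  snoc : ∀ xs → foldr _+_ 0ℚ (xs ++ (f n ∷ [])) ≡ foldr _+_ 0ℚ xs + f n
  snoc []       = ℚP.+-comm (f n) 0ℚ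
  snoc (x ∷ xs) = trans (cong (_+_ x) (snoc xs)) (sym (ℚP.+-assoc x _ (f n)))

-- A sum is characterised by its difference equation; linearity and congruence are instances.
sumQ-telescope : ∀ N {f} (F : ℕ → ℚ) → F 0 ≡ 0ℚ → (∀ n → n < N → F (suc n) ≡ F n + f n) → sumQ N f ≡ F N
sumQ-telescope zero    F F0 Fs = sym F0
sumQ-telescope (suc N) {f} F F0 Fs = begin
  sumQ (suc N) f ≡⟨ sumQ-suc N f ⟩
  sumQ N f + f N ≡⟨ cong (_+ f N) (sumQ-telescope N F F0 (λ n n<N → Fs n (ℕP.m<n⇒m<1+n n<N))) ⟩
  F N + f N      ≡⟨ Fs N (ℕP.n<1+n N) ⟨
  F (suc N)      ∎

sumQ-cong : ∀ N {f g} → (∀ n → n < N → f n ≡ g n) → sumQ N f ≡ sumQ N g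
sumQ-cong N {f} {g} f≡g = sumQ-telescope N (λ n → sumQ n g) refl
  (λ n n<N → trans (sumQ-suc n g) (cong (_+_ (sumQ n g)) (sym (f≡g n n<N))))

sumQ-*ˡ : ∀ N c f → c * sumQ N f ≡ sumQ N (λ n → c * f n)
sumQ-*ˡ N c f = sym (sumQ-telescope N (λ n → c * sumQ n f) (ℚP.*-zeroʳ c)
  (λ n _ → trans (cong (c *_) (sumQ-suc n f)) (ℚP.*-distribˡ-+ c _ _)))

sumQ-+ : ∀ N f g → sumQ N f + sumQ N g ≡ sumQ N (λ n → f n + g n)
sumQ-+ N f g = sym (sumQ-telescope N (λ n → sumQ n f + sumQ n g) refl
  (λ n _ → trans (cong₂ _+_ (sumQ-suc n f) (sumQ-suc n g)) (interchange (sumQ n f) (f n) (sumQ n g) (g n))))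
  where
  interchange : ∀ a b c d → a + b + (c + d) ≡ a + c + (b + d)
  interchange = solve-∀ ℚ-ring

sumQ-sub : ∀ N f g → sumQ N f - sumQ N g ≡ sumQ N (λ n → f n - g n)
sumQ-sub N f g = sym (sumQ-telescope N (λ n → sumQ n f - sumQ n g) refl
  (λ n _ → trans (cong₂ _-_ (sumQ-suc n f) (sumQ-suc n g)) (interchange (sumQ n f) (f n) (sumQ n g) (g n))))
  where
  interchange : ∀ a b c d → a + b - (c + d) ≡ a - c + (b - d)
  interchange = solve-∀ ℚ-ring

sumQ-extend : ∀ {m N f} → m ℕ.≤′ N → (∀ k → m ≤ k → f k ≡ 0ℚ) → sumQ N f ≡ sumQ m f
sumQ-extend ℕ.≤′-refl f≡0 = refl
sumQ-extend {m} {suc N} {f} (ℕ.≤′-step m≤N) f≡0 = begin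
  sumQ (suc N) f ≡⟨ sumQ-suc N f ⟩
  sumQ N f + f N ≡⟨ cong (_+_ (sumQ N f)) (f≡0 N (ℕP.≤′⇒≤ m≤N)) ⟩
  sumQ N f + 0ℚ  ≡⟨ ℚP.+-identityʳ _ ⟩
  sumQ N f       ≡⟨ sumQ-extend m≤N f≡0 ⟩
  sumQ m f       ∎

ℤ→ℚ-sumℤ : ∀ N f → ℤ→ℚ (sumℤ N f) ≡ sumQ N (ℤ→ℚ ∘ f)
ℤ→ℚ-sumℤ N f = go (upTo N)
  where
  go : ∀ xs → ℤ→ℚ (foldr ℤ._+_ (+ 0) (map f xs)) ≡ foldr _+_ 0ℚ (map (ℤ→ℚ ∘ f) xs)
  go []       = refl
  go (x ∷ xs) = trans (ℤ→ℚ-+ (f x) _) (cong (_+_ (ℤ→ℚ (f x))) (go xs))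

-- Generalised binomial coefficients

factorialQ≢0 : ∀ k → factorialQ k ≢ 0ℚ
factorialQ≢0 zero    ()
factorialQ≢0 (suc k) = *≢0 (factorialQ≢0 k) (ℕ→ℚ≢0 (suc k))

binomQ-suc : ∀ x k → ℕ→ℚ (suc k) * binomQ x (suc k) ≡ binomQ x k * (x - ℕ→ℚ k)
binomQ-suc x k = *-cancelˡ (factorialQ≢0 k) (begin
  factorialQ k * (ℕ→ℚ (suc k) * binomQ x (suc k)) ≡⟨ ℚP.*-assoc (factorialQ k) _ _ ⟨
  factorialQ (suc k) * binomQ x (suc k)           ≡⟨ ÷'-cancelˡ _ (factorialQ≢0 (suc k)) ⟩
  fallingQ x k * (x - ℕ→ℚ k)                      ≡⟨ cong (_* (x - ℕ→ℚ k)) (÷'-cancelˡ _ (factorialQ≢0 k)) ⟨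
  factorialQ k * binomQ x k * (x - ℕ→ℚ k)         ≡⟨ ℚP.*-assoc (factorialQ k) _ _ ⟩
  factorialQ k * (binomQ x k * (x - ℕ→ℚ k))       ∎)

-- Both sides grow by the same factor: x+1-(k+1) on the left, x-k on the right. This is the tool
-- that pulls a factor ν, and later p, out of a binomial coefficient.
binomQ-absorb : ∀ x k → ℕ→ℚ (suc k) * binomQ (x + 1ℚ) (suc k) ≡ (x + 1ℚ) * binomQ x k
binomQ-absorb x zero = trans (binomQ-suc (x + 1ℚ) 0) (eq (x + 1ℚ))
  where
  eq : ∀ y → 1ℚ * (y - 0ℚ) ≡ y * 1ℚ
  eq = solve-∀ ℚ-ring
binomQ-absorb x (suc k) = *-cancelˡ (ℕ→ℚ≢0 (suc k)) (begin
  K * (ℕ→ℚ (suc (suc k)) * binomQ (x + 1ℚ) (suc (suc k))) ≡⟨ cong (K *_) (binomQ-suc (x + 1ℚ) (suc k)) ⟩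
  K * (binomQ (x + 1ℚ) (suc k) * (x + 1ℚ - K))            ≡⟨ ℚP.*-assoc K _ _ ⟨
  K * binomQ (x + 1ℚ) (suc k) * (x + 1ℚ - K)              ≡⟨ cong₂ _*_ (binomQ-absorb x k) (cong (λ z → x + 1ℚ - z) (ℕ→ℚ-suc k)) ⟩
  (x + 1ℚ) * binomQ x k * (x + 1ℚ - (ℕ→ℚ k + 1ℚ))         ≡⟨ eq x (binomQ x k) (ℕ→ℚ k) ⟩
  (x + 1ℚ) * (binomQ x k * (x - ℕ→ℚ k))                   ≡⟨ cong ((x + 1ℚ) *_) (binomQ-suc x k) ⟨
  (x + 1ℚ) * (K * binomQ x (suc k))                       ≡⟨ eq′ (x + 1ℚ) K (binomQ x (suc k)) ⟩
  K * ((x + 1ℚ) * binomQ x (suc k))                       ∎)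
  where
  K = ℕ→ℚ (suc k)
  eq : ∀ x b k → (x + 1ℚ) * b * (x + 1ℚ - (k + 1ℚ)) ≡ (x + 1ℚ) * (b * (x - k))
  eq = solve-∀ ℚ-ring
  eq′ : ∀ a b c → a * (b * c) ≡ b * (a * c)
  eq′ = solve-∀ ℚ-ring

-- Absorption turns the left side into (x+1) C(x,k); splitting x+1 as (x-k) + (k+1) gives the two
-- terms on the right.
binomQ-pascal : ∀ x k → binomQ (x + 1ℚ) (suc k) ≡ binomQ x (suc k) + binomQ x k
binomQ-pascal x k = *-cancelˡ (ℕ→ℚ≢0 (suc k)) (begin
  ℕ→ℚ (suc k) * binomQ (x + 1ℚ) (suc k)                   ≡⟨ binomQ-absorb x k ⟩
  (x + 1ℚ) * binomQ x k                                   ≡⟨ eq x (binomQ x k) (ℕ→ℚ k) ⟩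
  binomQ x k * (x - ℕ→ℚ k) + (ℕ→ℚ k + 1ℚ) * binomQ x k    ≡⟨ cong₂ (λ u v → u + v * binomQ x k) (binomQ-suc x k) (ℕ→ℚ-suc k) ⟨
  ℕ→ℚ (suc k) * binomQ x (suc k) + ℕ→ℚ (suc k) * binomQ x k ≡⟨ ℚP.*-distribˡ-+ (ℕ→ℚ (suc k)) _ _ ⟨
  ℕ→ℚ (suc k) * (binomQ x (suc k) + binomQ x k)           ∎)
  where
  eq : ∀ x b k → (x + 1ℚ) * b ≡ b * (x - k) + (k + 1ℚ) * b
  eq = solve-∀ ℚ-ring

-- The zero factor x - n appears at k = n+1 and is inherited afterwards; the two constructors of
-- `_≤′_` separate exactly these cases.
binomQ-vanish : ∀ {n k} → n ℕ.<′ k → binomQ (ℕ→ℚ n) k ≡ 0ℚ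
binomQ-vanish {n} {zero} (ℕ.≤′-reflexive ())
binomQ-vanish {n} {suc k} n<k = *-cancelˡ (ℕ→ℚ≢0 (suc k)) (trans (trans (binomQ-suc (ℕ→ℚ n) k) (last n<k)) (sym (ℚP.*-zeroʳ (ℕ→ℚ (suc k)))))
  where
  last : n ℕ.<′ suc k → binomQ (ℕ→ℚ n) k * (ℕ→ℚ n - ℕ→ℚ k) ≡ 0ℚ
  last (ℕ.≤′-reflexive refl) = trans (cong (binomQ (ℕ→ℚ n) n *_) (ℚP.+-inverseʳ (ℕ→ℚ n))) (ℚP.*-zeroʳ (binomQ (ℕ→ℚ n) n))
  last (ℕ.≤′-step n<k)       = trans (cong (_* (ℕ→ℚ n - ℕ→ℚ k)) (binomQ-vanish n<k)) (ℚP.*-zeroˡ (ℕ→ℚ n - ℕ→ℚ k))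

binomQ-ℕ : ∀ n k → ℕ→ℚ (n C k) ≡ binomQ (ℕ→ℚ n) k
binomQ-ℕ zero    zero    = refl
binomQ-ℕ (suc n) zero    = refl
binomQ-ℕ zero    (suc k) = trans (cong ℕ→ℚ (k>n⇒nCk≡0 {0} {suc k} (ℕ.s≤s ℕ.z≤n))) (sym (binomQ-vanish {0} {suc k} (ℕP.<⇒<′ (ℕ.s≤s ℕ.z≤n))))
binomQ-ℕ (suc n) (suc k) = begin
  ℕ→ℚ (suc n C suc k)                       ≡⟨ cong ℕ→ℚ (nCk+nC[k+1]≡[n+1]C[k+1] n k) ⟨
  ℕ→ℚ (n C k ℕ.+ n C suc k)                 ≡⟨ ℕ→ℚ-+ (n C k) (n C suc k) ⟩
  ℕ→ℚ (n C k) + ℕ→ℚ (n C suc k)             ≡⟨ cong₂ _+_ (binomQ-ℕ n k) (binomQ-ℕ n (suc k)) ⟩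
  binomQ (ℕ→ℚ n) k + binomQ (ℕ→ℚ n) (suc k) ≡⟨ ℚP.+-comm (binomQ (ℕ→ℚ n) k) _ ⟩
  binomQ (ℕ→ℚ n) (suc k) + binomQ (ℕ→ℚ n) k ≡⟨ binomQ-pascal (ℕ→ℚ n) k ⟨
  binomQ (ℕ→ℚ n + 1ℚ) (suc k)               ≡⟨ cong (λ z → binomQ z (suc k)) (ℕ→ℚ-suc n) ⟨
  binomQ (ℕ→ℚ (suc n)) (suc k)              ∎

-- Needed because p - 1 ≡ -1, so that C(p-1,k) ≡ (-1)^k modulo p for k < p.
binomQ--1 : ∀ k → binomQ (- 1ℚ) k ≡ signQ k
binomQ--1 zero    = refl
binomQ--1 (suc k) = *-cancelˡ (ℕ→ℚ≢0 (suc k)) (begin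
  ℕ→ℚ (suc k) * binomQ (- 1ℚ) (suc k) ≡⟨ binomQ-suc (- 1ℚ) k ⟩
  binomQ (- 1ℚ) k * (- 1ℚ - ℕ→ℚ k)    ≡⟨ cong (_* (- 1ℚ - ℕ→ℚ k)) (binomQ--1 k) ⟩
  signQ k * (- 1ℚ - ℕ→ℚ k)            ≡⟨ eq (signQ k) (ℕ→ℚ k) ⟩
  (ℕ→ℚ k + 1ℚ) * - signQ k            ≡⟨ cong (_* - signQ k) (ℕ→ℚ-suc k) ⟨
  ℕ→ℚ (suc k) * - signQ k             ∎)
  where
  eq : ∀ s k → s * (- 1ℚ - k) ≡ (k + 1ℚ) * - s
  eq = solve-∀ ℚ-ring

signQ² : ∀ k → signQ k * signQ k ≡ 1ℚ
signQ² zero    = refl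
signQ² (suc k) = trans (eq (signQ k)) (signQ² k)
  where
  eq : ∀ s → - s * - s ≡ s * s
  eq = solve-∀ ℚ-ring

-- The recurrence in n

coeff : ℚ → ℕ → ℚ
coeff x k = signQ k * binomQ x k * binomQ (- 1ℚ - x) k

-- The sign change and the two new binomial factors combine to -(x-k)(-1-x-k) = (x-k)(x+k+1), which
-- is symmetric under x ↦ -1-x and so depends on x only through t.
coeff-suc : ∀ x k → ℕ→ℚ (suc k) * ℕ→ℚ (suc k) * coeff x (suc k) ≡ (x * (x + 1ℚ) - ℕ→ℚ k * (ℕ→ℚ k + 1ℚ)) * coeff x k
coeff-suc x k = begin
  K * K * (- s * binomQ x (suc k) * binomQ y (suc k))       ≡⟨ eq₁ K s (binomQ x (suc k)) (binomQ y (suc k)) ⟩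
  - s * (K * binomQ x (suc k)) * (K * binomQ y (suc k))     ≡⟨ cong₂ (λ u v → - s * u * v) (binomQ-suc x k) (binomQ-suc y k) ⟩
  - s * (binomQ x k * (x - ℕ→ℚ k)) * (binomQ y k * (y - ℕ→ℚ k)) ≡⟨ eq₂ s (binomQ x k) (binomQ y k) x (ℕ→ℚ k) ⟩
  (x * (x + 1ℚ) - ℕ→ℚ k * (ℕ→ℚ k + 1ℚ)) * coeff x k         ∎
  where
  K = ℕ→ℚ (suc k)
  s = signQ k
  y = - 1ℚ - x
  eq₁ : ∀ K s b c → K * K * (- s * b * c) ≡ - s * (K * b) * (K * c)
  eq₁ = solve-∀ ℚ-ring
  eq₂ : ∀ s b c x k → - s * (b * (x - k)) * (c * (- 1ℚ - x - k)) ≡ (x * (x + 1ℚ) - k * (k + 1ℚ)) * (s * b * c)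
  eq₂ = solve-∀ ℚ-ring

-- A range of summation independent of n makes the recurrences in n termwise identities; they hold for rational ν.
Gν : ℕ → ℚ → ℚ → ℚ
Gν N x ν = sumQ N (λ k → binomQ ν k * coeff x k)

Gν-suc : ∀ N x ν → Gν (suc N) x ν ≡ Gν N x ν + binomQ ν N * coeff x N
Gν-suc N x ν = sumQ-suc N (λ k → binomQ ν k * coeff x k)

G≡Gν : ∀ {n N} x → n < N → G n x ≡ Gν N x (ℕ→ℚ n)
G≡Gν {n} {N} x n<N = begin
  G n x                   ≡⟨ sumQ-cong (suc n) (λ k _ → trans (cong (λ z → z * signQ k * binomQ x k * binomQ (- 1ℚ - x) k) (binomQ-ℕ n k))
                               (eq (binomQ (ℕ→ℚ n) k) (signQ k) (binomQ x k) (binomQ (- 1ℚ - x) k))) ⟩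
  Gν (suc n) x (ℕ→ℚ n)    ≡⟨ sumQ-extend (ℕP.≤⇒≤′ n<N) (λ k n<k → trans (cong (_* coeff x k) (binomQ-vanish {n} {k} (ℕP.<⇒<′ n<k))) (ℚP.*-zeroˡ (coeff x k))) ⟨
  Gν N x (ℕ→ℚ n)          ∎
  where
  eq : ∀ a b c d → a * b * c * d ≡ a * (b * c * d)
  eq = solve-∀ ℚ-ring

-- u_ν of the header: ν² C(ν-1,k-1) = ν k C(ν,k).
Uν : ℕ → ℚ → ℚ → ℚ
Uν N x ν = sumQ N (λ k → ν * ℕ→ℚ k * binomQ ν k * coeff x k)

Uν-suc : ∀ N x ν → Uν (suc N) x ν ≡ Uν N x ν + ν * ℕ→ℚ N * binomQ ν N * coeff x N
Uν-suc N x ν = sumQ-suc N (λ k → ν * ℕ→ℚ k * binomQ ν k * coeff x k)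

Uν-0 : ∀ N x → Uν N x 0ℚ ≡ 0ℚ
Uν-0 N x = sumQ-telescope N (λ _ → 0ℚ) refl (λ k _ → eq (ℕ→ℚ k) (binomQ 0ℚ k) (coeff x k))
  where
  eq : ∀ k b a → 0ℚ ≡ 0ℚ + 0ℚ * k * b * a
  eq = solve-∀ ℚ-ring

-- Termwise: Pascal's rule makes the difference C(ν,k-1), and absorption rewrites (ν+1) C(ν,k-1) as
-- k C(ν+1,k).
Uν-difference : ∀ N x ν → Uν N x (ν + 1ℚ) ≡ (ν + 1ℚ) * (ν + 1ℚ) * (Gν N x (ν + 1ℚ) - Gν N x ν)
Uν-difference N x ν = begin
  Uν N x (ν + 1ℚ)                                        ≡⟨ sumQ-cong N (λ k _ → term k) ⟩
  sumQ N (λ k → V * (binomQ (ν + 1ℚ) k * coeff x k - binomQ ν k * coeff x k)) ≡⟨ sumQ-*ˡ N V _ ⟨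
  V * sumQ N (λ k → binomQ (ν + 1ℚ) k * coeff x k - binomQ ν k * coeff x k) ≡⟨ cong (V *_) (sumQ-sub N _ _) ⟨
  V * (Gν N x (ν + 1ℚ) - Gν N x ν)                       ∎
  where
  V = (ν + 1ℚ) * (ν + 1ℚ)
  eq₀ : ∀ w a → w * 0ℚ * 1ℚ * a ≡ w * w * (1ℚ * a - 1ℚ * a)
  eq₀ = solve-∀ ℚ-ring
  eq₁ : ∀ w k b a → w * k * b * a ≡ w * (k * b) * a
  eq₁ = solve-∀ ℚ-ring
  eq₂ : ∀ w b c a → w * (w * b) * a ≡ w * w * ((c + b) * a - c * a)
  eq₂ = solve-∀ ℚ-ring
  term : ∀ k → (ν + 1ℚ) * ℕ→ℚ k * binomQ (ν + 1ℚ) k * coeff x k ≡ V * (binomQ (ν + 1ℚ) k * coeff x k - binomQ ν k * coeff x k)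
  term zero    = eq₀ (ν + 1ℚ) (coeff x 0)
  term (suc k) = begin
    (ν + 1ℚ) * ℕ→ℚ (suc k) * binomQ (ν + 1ℚ) (suc k) * coeff x (suc k)   ≡⟨ eq₁ (ν + 1ℚ) (ℕ→ℚ (suc k)) _ (coeff x (suc k)) ⟩
    (ν + 1ℚ) * (ℕ→ℚ (suc k) * binomQ (ν + 1ℚ) (suc k)) * coeff x (suc k) ≡⟨ cong (λ z → (ν + 1ℚ) * z * coeff x (suc k)) (binomQ-absorb ν k) ⟩
    (ν + 1ℚ) * ((ν + 1ℚ) * binomQ ν k) * coeff x (suc k)                 ≡⟨ eq₂ (ν + 1ℚ) (binomQ ν k) (binomQ ν (suc k)) (coeff x (suc k)) ⟩
    V * ((binomQ ν (suc k) + binomQ ν k) * coeff x (suc k) - binomQ ν (suc k) * coeff x (suc k))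
      ≡⟨ cong (λ z → V * (z * coeff x (suc k) - binomQ ν (suc k) * coeff x (suc k))) (binomQ-pascal ν k) ⟨
    V * (binomQ (ν + 1ℚ) (suc k) * coeff x (suc k) - binomQ ν (suc k) * coeff x (suc k)) ∎

private
  -- The defect of cutting the sums off at k = M: by `coeff-suc` it equals (M+1)² a_{M+1} C(ν,M),
  -- the part of the first omitted term that the index shift would need.
  boundary : ℚ → ℚ → ℕ → ℚ
  boundary x ν M = (x * (x + 1ℚ) - ℕ→ℚ M * (ℕ→ℚ M + 1ℚ)) * coeff x M * binomQ ν M

-- With c_k = C(ν,k), the k-th term of U_{ν+1} - U_ν is k(k+1) c_k a_k + k² c_{k-1} a_k, and k² a_k
-- = (t - (k-1)k) a_{k-1}. After shifting the second part by one index the products k(k+1) cancel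
-- and t c_k a_k is left, except at the last index.
Uν-step-boundary : ∀ M x ν → Uν (suc M) x (ν + 1ℚ) + boundary x ν M ≡ Uν (suc M) x ν + x * (x + 1ℚ) * Gν (suc M) x ν
Uν-step-boundary zero x ν = eq ν x
  where
  eq : ∀ ν x → (ν + 1ℚ) * 0ℚ * 1ℚ * 1ℚ + 0ℚ + (x * (x + 1ℚ) - 0ℚ * (0ℚ + 1ℚ)) * 1ℚ * 1ℚ
             ≡ ν * 0ℚ * 1ℚ * 1ℚ + 0ℚ + x * (x + 1ℚ) * (1ℚ * 1ℚ + 0ℚ)
  eq = solve-∀ ℚ-ring
Uν-step-boundary (suc M) x ν = begin
  Uν (suc (suc M)) x (ν + 1ℚ) + boundary x ν (suc M)
    ≡⟨ cong₂ _+_ (Uν-suc (suc M) x (ν + 1ℚ)) (cong (λ z → (t - z * (z + 1ℚ)) * a * b) (ℕ→ℚ-suc M)) ⟩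
  Uν (suc M) x (ν + 1ℚ) + (ν + 1ℚ) * K * binomQ (ν + 1ℚ) (suc M) * a + (t - (ℕ→ℚ M + 1ℚ) * (ℕ→ℚ M + 1ℚ + 1ℚ)) * a * b
    ≡⟨ cong₂ (λ k c → Uν (suc M) x (ν + 1ℚ) + (ν + 1ℚ) * k * c * a + (t - (ℕ→ℚ M + 1ℚ) * (ℕ→ℚ M + 1ℚ + 1ℚ)) * a * b) (ℕ→ℚ-suc M) (binomQ-pascal ν M) ⟩
  Uν (suc M) x (ν + 1ℚ) + (ν + 1ℚ) * (ℕ→ℚ M + 1ℚ) * (b + b₀) * a + (t - (ℕ→ℚ M + 1ℚ) * (ℕ→ℚ M + 1ℚ + 1ℚ)) * a * b
    -- The regrouping exposes (M+1)² a, ready for `coeff-suc`, and b₀ (ν - M) - (M+1) b, which is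
    -- zero by `binomQ-suc`.
    ≡⟨ eq₁ (Uν (suc M) x (ν + 1ℚ)) ν (ℕ→ℚ M) b b₀ a t ⟩
  Uν (suc M) x (ν + 1ℚ) + (ℕ→ℚ M + 1ℚ) * (ℕ→ℚ M + 1ℚ) * a * b₀
    + (ℕ→ℚ M + 1ℚ) * (b₀ * (ν - ℕ→ℚ M) - (ℕ→ℚ M + 1ℚ) * b) * a
    + (ν * (ℕ→ℚ M + 1ℚ) * b * a + t * (b * a))
    ≡⟨ cong₂ (λ u v → Uν (suc M) x (ν + 1ℚ) + u * b₀ + (ℕ→ℚ M + 1ℚ) * v * a + (ν * (ℕ→ℚ M + 1ℚ) * b * a + t * (b * a))) rec₁ rec₂ ⟩
  Uν (suc M) x (ν + 1ℚ) + (t - ℕ→ℚ M * (ℕ→ℚ M + 1ℚ)) * coeff x M * b₀ + (ℕ→ℚ M + 1ℚ) * 0ℚ * a + (ν * (ℕ→ℚ M + 1ℚ) * b * a + t * (b * a))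
    ≡⟨ cong₂ (λ u k → u + (ℕ→ℚ M + 1ℚ) * 0ℚ * a + (ν * k * b * a + t * (b * a))) (Uν-step-boundary M x ν) (sym (ℕ→ℚ-suc M)) ⟩
  Uν (suc M) x ν + t * Gν (suc M) x ν + (ℕ→ℚ M + 1ℚ) * 0ℚ * a + (ν * K * b * a + t * (b * a))
    ≡⟨ eq₂ (Uν (suc M) x ν) t (Gν (suc M) x ν) (ℕ→ℚ M) a (ν * K * b * a) (b * a) ⟩
  Uν (suc M) x ν + ν * K * b * a + t * (Gν (suc M) x ν + b * a)
    ≡⟨ cong₂ (λ u v → u + t * v) (Uν-suc (suc M) x ν) (Gν-suc (suc M) x ν) ⟨
  Uν (suc (suc M)) x ν + t * Gν (suc (suc M)) x ν ∎
  where
  t  = x * (x + 1ℚ)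
  K  = ℕ→ℚ (suc M)
  a  = coeff x (suc M)
  b  = binomQ ν (suc M)
  b₀ = binomQ ν M
  rec₁ : (ℕ→ℚ M + 1ℚ) * (ℕ→ℚ M + 1ℚ) * a ≡ (t - ℕ→ℚ M * (ℕ→ℚ M + 1ℚ)) * coeff x M
  rec₁ = trans (cong (λ k → k * k * a) (sym (ℕ→ℚ-suc M))) (coeff-suc x M)
  rec₂ : b₀ * (ν - ℕ→ℚ M) - (ℕ→ℚ M + 1ℚ) * b ≡ 0ℚ
  rec₂ = trans (cong₂ (λ u k → u - k * b) (sym (binomQ-suc ν M)) (sym (ℕ→ℚ-suc M))) (ℚP.+-inverseʳ (K * b))
  eq₁ : ∀ u ν m b b₀ a t → u + (ν + 1ℚ) * (m + 1ℚ) * (b + b₀) * a + (t - (m + 1ℚ) * (m + 1ℚ + 1ℚ)) * a * b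
      ≡ u + (m + 1ℚ) * (m + 1ℚ) * a * b₀ + (m + 1ℚ) * (b₀ * (ν - m) - (m + 1ℚ) * b) * a + (ν * (m + 1ℚ) * b * a + t * (b * a))
  eq₁ = solve-∀ ℚ-ring
  eq₂ : ∀ u t g m a c d → u + t * g + (m + 1ℚ) * 0ℚ * a + (c + t * d) ≡ u + c + t * (g + d)
  eq₂ = solve-∀ ℚ-ring

-- The defect carries the factor C(n,M), which is zero since n < M.
Uν-step : ∀ {n M} x → n < M → Uν (suc M) x (ℕ→ℚ n + 1ℚ) ≡ Uν (suc M) x (ℕ→ℚ n) + x * (x + 1ℚ) * Gν (suc M) x (ℕ→ℚ n)
Uν-step {n} {M} x n<M = begin
  u                            ≡⟨ ℚP.+-identityʳ u ⟨
  u + 0ℚ                       ≡⟨ cong (_+_ u) (ℚP.*-zeroʳ c) ⟨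
  u + c * 0ℚ                   ≡⟨ cong (λ z → u + c * z) (binomQ-vanish {n} {M} (ℕP.<⇒<′ n<M)) ⟨
  u + boundary x (ℕ→ℚ n) M     ≡⟨ Uν-step-boundary M x (ℕ→ℚ n) ⟩
  Uν (suc M) x (ℕ→ℚ n) + x * (x + 1ℚ) * Gν (suc M) x (ℕ→ℚ n) ∎
  where
  u = Uν (suc M) x (ℕ→ℚ n + 1ℚ)
  c = (x * (x + 1ℚ) - ℕ→ℚ M * (ℕ→ℚ M + 1ℚ)) * coeff x M

sum-Gν : ∀ M x {m} → m ≤ M → x * (x + 1ℚ) * sumQ m (λ n → Gν (suc M) x (ℕ→ℚ n)) ≡ Uν (suc M) x (ℕ→ℚ m)
sum-Gν M x {m} m≤M = trans (sumQ-*ˡ m (x * (x + 1ℚ)) _)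
  (sumQ-telescope m (λ n → Uν (suc M) x (ℕ→ℚ n)) (Uν-0 (suc M) x)
    (λ n n<m → trans (cong (Uν (suc M) x) (ℕ→ℚ-suc n)) (Uν-step {n} {M} x (ℕP.<-≤-trans n<m m≤M))))

-- Two summations by parts are combined in `F`. From t G_n = u_{n+1} - u_n, the sum of t n G_n is m
-- u_m minus the sum of the u_{n+1}. As u_{n+1} = (n+1)² (G_{n+1} - G_n), the latter sum is m² G_m
-- minus the sum of (2n+1) G_n; the part 2n G_n moves to the left and explains t - 2.
sum-nGν : ∀ M x {m} → m ≤ M →
  (x * (x + 1ℚ) - (1ℚ + 1ℚ)) * sumQ m (λ n → ℕ→ℚ n * Gν (suc M) x (ℕ→ℚ n))
    ≡ ℕ→ℚ m * Uν (suc M) x (ℕ→ℚ m) - ℕ→ℚ m * ℕ→ℚ m * Gν (suc M) x (ℕ→ℚ m) + sumQ m (λ n → Gν (suc M) x (ℕ→ℚ n))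
sum-nGν M x {m} m≤M = trans (sumQ-*ˡ m (t - (1ℚ + 1ℚ)) _) (sumQ-telescope m F F0 step)
  where
  t = x * (x + 1ℚ)
  g : ℕ → ℚ
  g n = Gν (suc M) x (ℕ→ℚ n)
  F : ℕ → ℚ
  F n = ℕ→ℚ n * Uν (suc M) x (ℕ→ℚ n) - ℕ→ℚ n * ℕ→ℚ n * g n + sumQ n g
  eq₀ : ∀ u g → 0ℚ * u - 0ℚ * 0ℚ * g + 0ℚ ≡ 0ℚ
  eq₀ = solve-∀ ℚ-ring
  F0 : F 0 ≡ 0ℚ
  F0 = eq₀ (Uν (suc M) x 0ℚ) (g 0)
  eq₁ : ∀ n u g s u′ g′ t → (n + 1ℚ) * u′ - (n + 1ℚ) * (n + 1ℚ) * g′ + (s + g)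
      ≡ n * u - n * n * g + s + (t - (1ℚ + 1ℚ)) * (n * g) + n * (u′ - (u + t * g)) + (u′ - (n + 1ℚ) * (n + 1ℚ) * (g′ - g))
  eq₁ = solve-∀ ℚ-ring
  eq₂ : ∀ a n b c → a + n * (b - b) + (c - c) ≡ a
  eq₂ = solve-∀ ℚ-ring
  step : ∀ n → n < m → F (suc n) ≡ F n + (t - (1ℚ + 1ℚ)) * (ℕ→ℚ n * g n)
  step n n<m = begin
    F (suc n)
      ≡⟨ cong₂ (λ z w → z * Uν (suc M) x z - z * z * Gν (suc M) x z + w) (ℕ→ℚ-suc n) (sumQ-suc n g) ⟩
    (ℕ→ℚ n + 1ℚ) * u′ - (ℕ→ℚ n + 1ℚ) * (ℕ→ℚ n + 1ℚ) * g′ + (sumQ n g + g n)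
      -- The last two summands are the two recurrences written as differences; each becomes zero in
      -- the next rewriting.
      ≡⟨ eq₁ (ℕ→ℚ n) u (g n) (sumQ n g) u′ g′ t ⟩
    F n + (t - (1ℚ + 1ℚ)) * (ℕ→ℚ n * g n) + ℕ→ℚ n * (u′ - (u + t * g n)) + (u′ - (ℕ→ℚ n + 1ℚ) * (ℕ→ℚ n + 1ℚ) * (g′ - g n))
      ≡⟨ cong₂ (λ v w → F n + (t - (1ℚ + 1ℚ)) * (ℕ→ℚ n * g n) + ℕ→ℚ n * (v - (u + t * g n)) + (w - (ℕ→ℚ n + 1ℚ) * (ℕ→ℚ n + 1ℚ) * (g′ - g n)))
           (Uν-step {n} {M} x (ℕP.<-≤-trans n<m m≤M)) (Uν-difference (suc M) x (ℕ→ℚ n)) ⟩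
    _ ≡⟨ eq₂ (F n + (t - (1ℚ + 1ℚ)) * (ℕ→ℚ n * g n)) (ℕ→ℚ n) (u + t * g n) ((ℕ→ℚ n + 1ℚ) * (ℕ→ℚ n + 1ℚ) * (g′ - g n)) ⟩
    F n + (t - (1ℚ + 1ℚ)) * (ℕ→ℚ n * g n) ∎
    where
    u  = Uν (suc M) x (ℕ→ℚ n)
    u′ = Uν (suc M) x (ℕ→ℚ n + 1ℚ)
    g′ = Gν (suc M) x (ℕ→ℚ n + 1ℚ)

sum-nG : ∀ q x → let P = ℕ→ℚ (suc q); t = x * (x + 1ℚ); g = G (suc q) x; g′ = G q x in
  (x - 1ℚ) * x * (x + 1ℚ) * (x + ℕ→ℚ 2) * sumQ (suc q) (λ n → ℕ→ℚ n * G n x)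
    ≡ P * P * ((1ℚ - t) * g - g′ + P * t * (g - g′))
sum-nG q x = begin
  (x - 1ℚ) * x * (x + 1ℚ) * (x + ℕ→ℚ 2) * sumQ p (λ n → ℕ→ℚ n * G n x)
    ≡⟨ cong (D *_) (sumQ-cong p (λ n n<p → cong (ℕ→ℚ n *_) (G≡Gν x (ℕP.m<n⇒m<1+n n<p)))) ⟩
  D * S                                              ≡⟨ eq₁ x S ⟩
  t * ((t - (1ℚ + 1ℚ)) * S)                          ≡⟨ cong (t *_) (sum-nGν p x ℕP.≤-refl) ⟩
  t * (P * u - P * P * γ + s)                        ≡⟨ eq₂ t P u γ s ⟩
  t * P * u - t * P * P * γ + t * s                  ≡⟨ cong (λ z → t * P * u - t * P * P * γ + z) (sum-Gν p x ℕP.≤-refl) ⟩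
  t * P * u - t * P * P * γ + u                      ≡⟨ cong (λ z → t * P * z - t * P * P * γ + z) U-eq ⟩
  t * P * (P * P * (γ - γ′)) - t * P * P * γ + P * P * (γ - γ′) ≡⟨ eq₃ t P γ γ′ ⟩
  P * P * ((1ℚ - t) * γ - γ′ + P * t * (γ - γ′))
    ≡⟨ cong₂ (λ g g′ → P * P * ((1ℚ - t) * g - g′ + P * t * (g - g′))) (G≡Gν x (ℕP.n<1+n p)) (G≡Gν x (ℕP.m<n⇒m<1+n (ℕP.n<1+n q))) ⟨
  P * P * ((1ℚ - t) * G p x - G q x + P * t * (G p x - G q x)) ∎
  where
  p  = suc q
  P  = ℕ→ℚ p
  t  = x * (x + 1ℚ)
  D  = (x - 1ℚ) * x * (x + 1ℚ) * (x + ℕ→ℚ 2)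
  S  = sumQ p (λ n → ℕ→ℚ n * Gν (suc p) x (ℕ→ℚ n))
  s  = sumQ p (λ n → Gν (suc p) x (ℕ→ℚ n))
  u  = Uν (suc p) x P
  γ  = Gν (suc p) x P
  γ′ = Gν (suc p) x (ℕ→ℚ q)
  U-eq : u ≡ P * P * (γ - γ′)
  U-eq = subst (λ z → Uν (suc p) x z ≡ z * z * (Gν (suc p) x z - γ′)) (sym (ℕ→ℚ-suc q)) (Uν-difference (suc p) x (ℕ→ℚ q))
  eq₁ : ∀ x S → (x - 1ℚ) * x * (x + 1ℚ) * (x + (1ℚ + 1ℚ)) * S ≡ x * (x + 1ℚ) * ((x * (x + 1ℚ) - (1ℚ + 1ℚ)) * S)
  eq₁ = solve-∀ ℚ-ring
  eq₂ : ∀ t P u g s → t * (P * u - P * P * g + s) ≡ t * P * u - t * P * P * g + t * s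
  eq₂ = solve-∀ ℚ-ring
  eq₃ : ∀ t P g g′ → t * P * (P * P * (g - g′)) - t * P * P * g + P * P * (g - g′) ≡ P * P * ((1ℚ - t) * g - g′ + P * t * (g - g′))
  eq₃ = solve-∀ ℚ-ring

-- The diagonal sum of C(r,k) C(-1-r,k)

private
  double : ℚ → ℚ
  double a = a + a

-- Since -1-x = y+1, Pascal's rule applies to one factor of each product. With a, b the binomial
-- coefficients of x, y at k and a′, b′ those at k+1, the two products at k+1 add up to 2a′b′ + (ab′
-- + a′b), and `cross` evaluates the bracket as -2ab. The sum thus telescopes and only its last term
-- survives.
diagonal-sum-step : ∀ N x → let y = - 1ℚ - (x + 1ℚ) in
  sumQ (suc N) (λ k → binomQ (x + 1ℚ) k * binomQ y k) + sumQ (suc N) (λ k → binomQ x k * binomQ (- 1ℚ - x) k)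
    ≡ double (binomQ x N * binomQ y N)
diagonal-sum-step N x = trans (sumQ-+ (suc N) (λ k → binomQ (x + 1ℚ) k * binomQ y k) (λ k → binomQ x k * binomQ (- 1ℚ - x) k)) (sumQ-telescope (suc N) F refl step)
  where
  y = - 1ℚ - (x + 1ℚ)
  F : ℕ → ℚ
  F zero    = 0ℚ
  F (suc k) = double (binomQ x k * binomQ y k)
  y+1 : - 1ℚ - x ≡ y + 1ℚ
  y+1 = eq x
    where
    eq : ∀ x → - 1ℚ - x ≡ - 1ℚ - (x + 1ℚ) + 1ℚ
    eq = solve-∀ ℚ-ring
  -- After multiplication by k+1 the left side is ab ((y-k) + (x-k)), and x + y = -2.
  cross : ∀ k → binomQ x k * binomQ y (suc k) + binomQ x (suc k) * binomQ y k ≡ - double (binomQ x k * binomQ y k)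
  cross k = *-cancelˡ (ℕ→ℚ≢0 (suc k)) (begin
    K * (a * b′ + a′ * b)                                        ≡⟨ eq₁ K a b a′ b′ ⟩
    a * (K * b′) + (K * a′) * b                                  ≡⟨ cong₂ (λ u v → a * u + v * b) (binomQ-suc y k) (binomQ-suc x k) ⟩
    a * (b * (y - ℕ→ℚ k)) + a * (x - ℕ→ℚ k) * b                  ≡⟨ eq₂ a b x (ℕ→ℚ k) ⟩
    (ℕ→ℚ k + 1ℚ) * - (a * b + a * b)                             ≡⟨ cong (_* - double (a * b)) (ℕ→ℚ-suc k) ⟨
    K * - double (a * b)                                         ∎)
    where
    K = ℕ→ℚ (suc k)
    a = binomQ x k
    b = binomQ y k
    a′ = binomQ x (suc k)
    b′ = binomQ y (suc k)
    eq₁ : ∀ K a b a′ b′ → K * (a * b′ + a′ * b) ≡ a * (K * b′) + (K * a′) * b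
    eq₁ = solve-∀ ℚ-ring
    eq₂ : ∀ a b x k → a * (b * (- 1ℚ - (x + 1ℚ) - k)) + a * (x - k) * b ≡ (k + 1ℚ) * - (a * b + a * b)
    eq₂ = solve-∀ ℚ-ring
  step : ∀ k → k < suc N → F (suc k) ≡ F k + (binomQ (x + 1ℚ) k * binomQ y k + binomQ x k * binomQ (- 1ℚ - x) k)
  step zero    _ = refl
  step (suc k) _ = begin
    a′ * b′ + a′ * b′                                     ≡⟨ eq₁ a b a′ b′ ⟩
    a * b + a * b + ((a′ + a) * b′ + a′ * (b′ + b)) + (- (a * b + a * b) - (a * b′ + a′ * b))
      ≡⟨ cong (λ z → a * b + a * b + ((a′ + a) * b′ + a′ * (b′ + b)) + (z - (a * b′ + a′ * b))) (cross k) ⟨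
    a * b + a * b + ((a′ + a) * b′ + a′ * (b′ + b)) + ((a * b′ + a′ * b) - (a * b′ + a′ * b))
      ≡⟨ eq₂ (a * b + a * b + ((a′ + a) * b′ + a′ * (b′ + b))) (a * b′ + a′ * b) ⟩
    a * b + a * b + ((a′ + a) * b′ + a′ * (b′ + b))
      ≡⟨ cong₂ (λ u v → a * b + a * b + (u * b′ + a′ * v)) (binomQ-pascal x k)
           (trans (cong (λ z → binomQ z (suc k)) y+1) (binomQ-pascal y k)) ⟨
    a * b + a * b + (binomQ (x + 1ℚ) (suc k) * b′ + a′ * binomQ (- 1ℚ - x) (suc k)) ∎
    where
    a = binomQ x k
    b = binomQ y k
    a′ = binomQ x (suc k)
    b′ = binomQ y (suc k)
    eq₁ : ∀ a b a′ b′ → a′ * b′ + a′ * b′ ≡ a * b + a * b + ((a′ + a) * b′ + a′ * (b′ + b)) + (- (a * b + a * b) - (a * b′ + a′ * b))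
    eq₁ = solve-∀ ℚ-ring
    eq₂ : ∀ a b → a + (b - b) ≡ a
    eq₂ = solve-∀ ℚ-ring

-- For i < N the surviving term contains C(i,N) = 0, so the sums at i+1 and i are opposite; at i = 0
-- only the term k = 0 is nonzero. The range is independent of i so that consecutive sums can be
-- compared.
diagonal-sum : ∀ {N} i → i ≤ N → sumQ (suc N) (λ k → binomQ (ℕ→ℚ i) k * binomQ (- 1ℚ - ℕ→ℚ i) k) ≡ signQ i
diagonal-sum {N} zero    _   = sumQ-extend {1} {suc N} (ℕP.≤⇒≤′ (ℕ.s≤s ℕ.z≤n))
  (λ k 1≤k → trans (cong (_* binomQ (- 1ℚ - 0ℚ) k) (binomQ-vanish {0} {k} (ℕP.<⇒<′ 1≤k))) (ℚP.*-zeroˡ (binomQ (- 1ℚ - 0ℚ) k)))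
diagonal-sum {N} (suc i) i<N = begin
  H (ℕ→ℚ (suc i))                            ≡⟨ cong H (ℕ→ℚ-suc i) ⟩
  H (ℕ→ℚ i + 1ℚ)                             ≡⟨ eq₁ (H (ℕ→ℚ i + 1ℚ)) (H (ℕ→ℚ i)) ⟩
  H (ℕ→ℚ i + 1ℚ) + H (ℕ→ℚ i) - H (ℕ→ℚ i)     ≡⟨ cong₂ _-_ (diagonal-sum-step N (ℕ→ℚ i)) (diagonal-sum i (ℕP.<⇒≤ i<N)) ⟩
  double (binomQ (ℕ→ℚ i) N * b) - signQ i    ≡⟨ cong (λ z → double (z * b) - signQ i) (binomQ-vanish {i} {N} (ℕP.<⇒<′ i<N)) ⟩
  double (0ℚ * b) - signQ i                  ≡⟨ eq₂ b (signQ i) ⟩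
  - signQ i                                  ∎
  where
  H : ℚ → ℚ
  H x = sumQ (suc N) (λ k → binomQ x k * binomQ (- 1ℚ - x) k)
  b = binomQ (- 1ℚ - (ℕ→ℚ i + 1ℚ)) N
  eq₁ : ∀ a b → a ≡ a + b - b
  eq₁ = solve-∀ ℚ-ring
  eq₂ : ∀ b s → 0ℚ * b + 0ℚ * b - s ≡ - s
  eq₂ = solve-∀ ℚ-ring

-- p-integral rationals and congruences modulo p

-- Any denominator prime to p is accepted, in lowest terms or not, so that closure under sums and
-- products involves no gcd.
record Integral (p : ℕ) (q : ℚ) : Set where
  constructor integral
  field
    den     : ℕ
    num     : ℤ
    p∤den   : ¬ p ∣ den
    den*q   : ℕ→ℚ den * q ≡ ℤ→ℚ num

↧*q≡↥ : ∀ q → ℕ→ℚ (↧ₙ q) * q ≡ ℤ→ℚ (↥ q)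
↧*q≡↥ q@(mkℚ n d-1 c) = ℚP.toℚᵘ-injective (ℚᵘP.≃-trans (ℚP.toℚᵘ-homo-* (ℕ→ℚ (suc d-1)) q)
  (ℚᵘP.≃-trans (ℚᵘP.*-cong (toℚᵘ-ℤ→ℚ (+ suc d-1)) ℚᵘP.≃-refl)
  (ℚᵘP.≃-trans (*≡* eq) (ℚᵘP.≃-sym (toℚᵘ-ℤ→ℚ n)))))
  where
  eq : + suc d-1 ℤ.* n ℤ.* + 1 ≡ n ℤ.* (+ (1 ℕ.* suc d-1))
  eq = trans (ℤP.*-identityʳ _) (trans (ℤP.*-comm (+ suc d-1) n) (cong (λ z → n ℤ.* (+ z)) (sym (ℕP.*-identityˡ (suc d-1)))))

InZp⇒Integral : ∀ {p q} → InZp p q → Integral p q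
InZp⇒Integral {q = q} p∤ = integral (↧ₙ q) (↥ q) p∤ (↧*q≡↥ q)

-- Cross-multiplication and coprimality show that the reduced denominator divides every other
-- denominator, so p cannot divide it.
Integral⇒InZp : ∀ {p q} → Integral p q → InZp p q
Integral⇒InZp {p} {q@(mkℚ n d-1 c)} (integral den num p∤den den*q) p∣↧ = p∤den (∣-trans p∣↧ ↧∣den)
  where
  d = suc d-1
  cross : ℤ→ℚ (+ den ℤ.* n) ≡ ℤ→ℚ (num ℤ.* + d)
  cross = begin
    ℤ→ℚ (+ den ℤ.* n)           ≡⟨ ℤ→ℚ-* (+ den) n ⟩
    ℕ→ℚ den * ℤ→ℚ n             ≡⟨ cong (ℕ→ℚ den *_) (↧*q≡↥ q) ⟨
    ℕ→ℚ den * (ℕ→ℚ d * q)       ≡⟨ eq (ℕ→ℚ den) (ℕ→ℚ d) q ⟩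
    (ℕ→ℚ den * q) * ℕ→ℚ d       ≡⟨ cong (_* ℕ→ℚ d) den*q ⟩
    ℤ→ℚ num * ℕ→ℚ d             ≡⟨ ℤ→ℚ-* num (+ d) ⟨
    ℤ→ℚ (num ℤ.* + d)           ∎
    where
    eq : ∀ a b c → a * (b * c) ≡ (a * c) * b
    eq = solve-∀ ℚ-ring
  abs-cross : ℤ.∣ n ∣ ℕ.* den ≡ ℤ.∣ num ∣ ℕ.* d
  abs-cross = begin
    ℤ.∣ n ∣ ℕ.* den       ≡⟨ ℕP.*-comm ℤ.∣ n ∣ den ⟩
    den ℕ.* ℤ.∣ n ∣       ≡⟨ ℤP.abs-* (+ den) n ⟨
    ℤ.∣ + den ℤ.* n ∣     ≡⟨ cong ℤ.∣_∣ (ℤ→ℚ-injective {+ den ℤ.* n} {num ℤ.* + d} cross) ⟩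
    ℤ.∣ num ℤ.* + d ∣     ≡⟨ ℤP.abs-* num (+ d) ⟩
    ℤ.∣ num ∣ ℕ.* d       ∎
  ↧∣den : d ∣ den
  ↧∣den = Coprimality.coprime-divisor (Coprimality.sym (Coprimality.recompute c)) (divides ℤ.∣ num ∣ abs-cross)

module Congruence {p : ℕ} (isPrime : Prime p) where

  P : ℚ
  P = ℕ→ℚ p

  P≢0 : P ≢ 0ℚ
  P≢0 = ℕ→ℚ≢0 p {{prime⇒nonZero isPrime}}

  ∤-* : ∀ {a b} → ¬ p ∣ a → ¬ p ∣ b → ¬ p ∣ a ℕ.* b
  ∤-* {a} {b} p∤a p∤b p∣ab with euclidsLemma a b isPrime p∣ab
  ... | inj₁ p∣a = p∤a p∣a
  ... | inj₂ p∣b = p∤b p∣b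

  ∤-< : ∀ {n} .{{_ : ℕ.NonZero n}} → n < p → ¬ p ∣ n
  ∤-< n<p p∣n = ℕP.<⇒≱ n<p (∣⇒≤ p∣n)

  p∤1 : ¬ p ∣ 1
  p∤1 = ∤-< (ℕ.nonTrivial⇒n>1 p {{prime⇒nonTrivial isPrime}})

  ℤ-integral : ∀ z → Integral p (ℤ→ℚ z)
  ℤ-integral z = integral 1 z p∤1 (ℚP.*-identityˡ (ℤ→ℚ z))

  ℕ-integral : ∀ n → Integral p (ℕ→ℚ n)
  ℕ-integral n = ℤ-integral (+ n)

  +-integral : ∀ {a b} → Integral p a → Integral p b → Integral p (a + b)
  +-integral {a} {b} (integral d m p∤d da) (integral e n p∤e eb) =
    integral (d ℕ.* e) (m ℤ.* + e ℤ.+ n ℤ.* + d) (∤-* p∤d p∤e) (begin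
      ℕ→ℚ (d ℕ.* e) * (a + b)                       ≡⟨ cong (_* (a + b)) (ℕ→ℚ-* d e) ⟩
      ℕ→ℚ d * ℕ→ℚ e * (a + b)                       ≡⟨ eq (ℕ→ℚ d) (ℕ→ℚ e) a b ⟩
      ℕ→ℚ d * a * ℕ→ℚ e + ℕ→ℚ e * b * ℕ→ℚ d         ≡⟨ cong₂ (λ u v → u * ℕ→ℚ e + v * ℕ→ℚ d) da eb ⟩
      ℤ→ℚ m * ℕ→ℚ e + ℤ→ℚ n * ℕ→ℚ d                 ≡⟨ cong₂ _+_ (ℤ→ℚ-* m (+ e)) (ℤ→ℚ-* n (+ d)) ⟨
      ℤ→ℚ (m ℤ.* + e) + ℤ→ℚ (n ℤ.* + d)             ≡⟨ ℤ→ℚ-+ (m ℤ.* + e) (n ℤ.* + d) ⟨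
      ℤ→ℚ (m ℤ.* + e ℤ.+ n ℤ.* + d)                 ∎)
    where
    eq : ∀ d e a b → d * e * (a + b) ≡ d * a * e + e * b * d
    eq = solve-∀ ℚ-ring

  *-integral : ∀ {a b} → Integral p a → Integral p b → Integral p (a * b)
  *-integral {a} {b} (integral d m p∤d da) (integral e n p∤e eb) =
    integral (d ℕ.* e) (m ℤ.* n) (∤-* p∤d p∤e) (begin
      ℕ→ℚ (d ℕ.* e) * (a * b)     ≡⟨ cong (_* (a * b)) (ℕ→ℚ-* d e) ⟩
      ℕ→ℚ d * ℕ→ℚ e * (a * b)     ≡⟨ eq (ℕ→ℚ d) (ℕ→ℚ e) a b ⟩
      ℕ→ℚ d * a * (ℕ→ℚ e * b)     ≡⟨ cong₂ _*_ da eb ⟩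
      ℤ→ℚ m * ℤ→ℚ n               ≡⟨ ℤ→ℚ-* m n ⟨
      ℤ→ℚ (m ℤ.* n)               ∎)
    where
    eq : ∀ d e a b → d * e * (a * b) ≡ d * a * (e * b)
    eq = solve-∀ ℚ-ring

  neg-integral : ∀ {a} → Integral p a → Integral p (- a)
  neg-integral {a} (integral d m p∤d da) = integral d (ℤ.- m) p∤d
    (trans (sym (ℚP.neg-distribʳ-* (ℕ→ℚ d) a)) (trans (cong -_ da) (sym (ℤ→ℚ-neg m))))

  sub-integral : ∀ {a b} → Integral p a → Integral p b → Integral p (a - b)
  sub-integral ia ib = +-integral ia (neg-integral ib)

  /-integral : ∀ {n a} → ¬ p ∣ n → Integral p (ℕ→ℚ n * a) → Integral p a
  /-integral {n} {a} p∤n (integral d m p∤d dna) = integral (d ℕ.* n) m (∤-* p∤d p∤n)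
    (trans (cong (_* a) (ℕ→ℚ-* d n)) (trans (ℚP.*-assoc (ℕ→ℚ d) (ℕ→ℚ n) a) dna))

  signQ-integral : ∀ k → Integral p (signQ k)
  signQ-integral zero    = ℕ-integral 1
  signQ-integral (suc k) = neg-integral (signQ-integral k)

  infix 4 _≈_
  -- The quotient is kept as data: the errors of G_p and G_{p-1} enter the final identity modulo p³
  -- as explicit terms, and matching on `equation` reduces congruences to ring identities.
  record _≈_ (a b : ℚ) : Set where
    constructor congruent
    field
      quotient : ℚ
      isIntegral : Integral p quotient
      equation : a ≡ b + P * quotient

  ≡⇒≈ : ∀ {a b} → a ≡ b → a ≈ b
  ≡⇒≈ {b = b} refl = congruent 0ℚ (ℕ-integral 0) (eq b P)
    where
    eq : ∀ b P → b ≡ b + P * 0ℚ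
    eq = solve-∀ ℚ-ring

  ≈-trans : ∀ {a b c} → a ≈ b → b ≈ c → a ≈ c
  ≈-trans {c = c} (congruent y iy refl) (congruent z iz refl) = congruent (z + y) (+-integral iz iy) (eq c P y z)
    where
    eq : ∀ c P y z → c + P * z + P * y ≡ c + P * (z + y)
    eq = solve-∀ ℚ-ring

  +-≈ : ∀ {a b c d} → a ≈ b → c ≈ d → a + c ≈ b + d
  +-≈ {b = b} {d = d} (congruent y iy refl) (congruent z iz refl) = congruent (y + z) (+-integral iy iz) (eq b d P y z)
    where
    eq : ∀ b d P y z → b + P * y + (d + P * z) ≡ b + d + P * (y + z)
    eq = solve-∀ ℚ-ring

  *-≈ : ∀ {a b c d} → Integral p b → Integral p d → a ≈ b → c ≈ d → a * c ≈ b * d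
  *-≈ {b = b} {d = d} ib id (congruent y iy refl) (congruent z iz refl) =
    congruent (y * d + b * z + P * y * z)
      (+-integral (+-integral (*-integral iy id) (*-integral ib iz)) (*-integral (*-integral (ℕ-integral p) iy) iz))
      (eq b d P y z)
    where
    eq : ∀ b d P y z → (b + P * y) * (d + P * z) ≡ b * d + P * (y * d + b * z + P * y * z)
    eq = solve-∀ ℚ-ring

  neg-≈ : ∀ {a b} → a ≈ b → - a ≈ - b
  neg-≈ {b = b} (congruent y iy refl) = congruent (- y) (neg-integral iy) (eq b P y)
    where
    eq : ∀ b P y → - (b + P * y) ≡ - b + P * - y
    eq = solve-∀ ℚ-ring

  cancel-≈ : ∀ {n a b} → ¬ p ∣ n → n ≢ 0 → ℕ→ℚ n * a ≈ ℕ→ℚ n * b → a ≈ b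
  cancel-≈ {zero} p∤n n≢0 _ = contradiction refl n≢0
  cancel-≈ {n@(suc _)} {a} {b} p∤n _ (congruent y iy na) =
    congruent (y ÷' ℕ→ℚ n) (/-integral p∤n (subst (Integral p) (sym n*y/n) iy)) (*-cancelˡ (ℕ→ℚ≢0 n) (begin
      ℕ→ℚ n * a                                   ≡⟨ na ⟩
      ℕ→ℚ n * b + P * y                           ≡⟨ cong (λ z → ℕ→ℚ n * b + P * z) n*y/n ⟨
      ℕ→ℚ n * b + P * (ℕ→ℚ n * (y ÷' ℕ→ℚ n))      ≡⟨ eq (ℕ→ℚ n) b P (y ÷' ℕ→ℚ n) ⟩
      ℕ→ℚ n * (b + P * (y ÷' ℕ→ℚ n))              ∎))
    where
    n*y/n : ℕ→ℚ n * (y ÷' ℕ→ℚ n) ≡ y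
    n*y/n = ÷'-cancelˡ y (ℕ→ℚ≢0 n)
    eq : ∀ n b P z → n * b + P * (n * z) ≡ n * (b + P * z)
    eq = solve-∀ ℚ-ring

  binomQ-integral : ∀ {x} k → k < p → Integral p x → Integral p (binomQ x k)
  binomQ-integral zero    _   _  = ℕ-integral 1
  binomQ-integral {x} (suc k) k<p ix = /-integral (∤-< k<p) (subst (Integral p) (sym (binomQ-suc x k))
    (*-integral (binomQ-integral k (ℕP.<⇒≤ k<p) ix) (sub-integral ix (ℕ-integral k))))

  -- Each step divides by some number from 1 to k, all prime to p while k < p. The argument stops at
  -- k = p, where the binomial coefficient is no longer determined by the residue of x.
  binomQ-≈ : ∀ {x y} k → k < p → Integral p y → x ≈ y → binomQ x k ≈ binomQ y k
  binomQ-≈ zero    _   _  _   = ≡⇒≈ refl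
  binomQ-≈ {x} {y} (suc k) k<p iy x≈y = cancel-≈ (∤-< k<p) (λ ())
    (≈-trans (≡⇒≈ (binomQ-suc x k))
    (≈-trans (*-≈ (binomQ-integral k (ℕP.<⇒≤ k<p) iy) (sub-integral iy (ℕ-integral k))
                (binomQ-≈ k (ℕP.<⇒≤ k<p) iy x≈y) (+-≈ x≈y (≡⇒≈ refl)))
             (≡⇒≈ (sym (binomQ-suc y k)))))

  sum-≈ : ∀ N {f g} → (∀ k → k < N → f k ≈ g k) → sumQ N f ≈ sumQ N g
  sum-≈ zero    f≈g = ≡⇒≈ refl
  sum-≈ (suc N) {f} {g} f≈g = ≈-trans (≡⇒≈ (sumQ-suc N f))
    (≈-trans (+-≈ (sum-≈ N (λ k k<N → f≈g k (ℕP.m<n⇒m<1+n k<N))) (f≈g N (ℕP.n<1+n N))) (≡⇒≈ (sym (sumQ-suc N g))))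

  -- Write D = z/d. If p divided z, then D/p would be integral, against the hypothesis; hence d/z is
  -- an integral inverse.
  unit-inverse : ∀ {D} → Integral p D → ¬ CongQ p 1 D 0ℚ → ∃[ i ] Integral p i × D * i ≡ 1ℚ
  unit-inverse {D} (integral d z p∤d dD) D≢0 = i , i-integral z refl , D*i
    where
    D/P : ((D - 0ℚ) ÷' ℕ→ℚ (p ℕ.^ 1)) ≡ D ÷' P
    D/P = cong₂ (λ a b → a ÷' ℕ→ℚ b) (ℚP.+-identityʳ D) (ℕP.*-identityʳ p)
    p∤z : ¬ p ∣ ℤ.∣ z ∣
    p∤z p∣z with SignedDivisibility.∣ᵤ⇒∣ {+ p} {z} p∣z
    ... | SignedDivisibility.divides w eq = D≢0 (subst (InZp p) (sym D/P) (Integral⇒InZp (integral d w p∤d (*-cancelˡ P≢0 (begin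
      P * (ℕ→ℚ d * (D ÷' P)) ≡⟨ swap P (ℕ→ℚ d) (D ÷' P) ⟩
      ℕ→ℚ d * (P * (D ÷' P)) ≡⟨ cong (ℕ→ℚ d *_) (÷'-cancelˡ D P≢0) ⟩
      ℕ→ℚ d * D              ≡⟨ dD ⟩
      ℤ→ℚ z                  ≡⟨ cong ℤ→ℚ (trans eq (ℤP.*-comm w (+ p))) ⟩
      ℤ→ℚ (+ p ℤ.* w)        ≡⟨ ℤ→ℚ-* (+ p) w ⟩
      P * ℤ→ℚ w              ∎)))))
      where
      swap : ∀ a b c → a * (b * c) ≡ b * (a * c)
      swap = solve-∀ ℚ-ring
    z≢0 : ℤ→ℚ z ≢ 0ℚ
    z≢0 eq with ℤ→ℚ-injective {z} {+ 0} eq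
    ... | refl = p∤z (divides 0 refl)
    i : ℚ
    i = ℕ→ℚ d ÷' ℤ→ℚ z
    z*i : ℤ→ℚ z * i ≡ ℕ→ℚ d
    z*i = ÷'-cancelˡ (ℕ→ℚ d) z≢0
    d≢0 : ℕ→ℚ d ≢ 0ℚ
    d≢0 eq with ℤ→ℚ-injective {+ d} {+ 0} eq
    ... | refl = p∤d (divides 0 refl)
    D*i : D * i ≡ 1ℚ
    D*i = *-cancelˡ d≢0 (begin
      ℕ→ℚ d * (D * i) ≡⟨ ℚP.*-assoc (ℕ→ℚ d) D i ⟨
      ℕ→ℚ d * D * i   ≡⟨ cong (_* i) dD ⟩
      ℤ→ℚ z * i       ≡⟨ z*i ⟩
      ℕ→ℚ d           ≡⟨ ℚP.*-identityʳ (ℕ→ℚ d) ⟨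
      ℕ→ℚ d * 1ℚ      ∎)
    -- `Integral` wants a natural denominator, so a negative z passes its sign to the numerator.
    i-integral : ∀ y → z ≡ y → Integral p i
    i-integral (+ n)    refl = integral n (+ d) p∤z z*i
    i-integral -[1+ n ] refl = integral (suc n) (ℤ.- + d) p∤z (begin
      ℕ→ℚ (suc n) * i          ≡⟨ eq (ℕ→ℚ (suc n)) i ⟩
      - (- ℕ→ℚ (suc n) * i)    ≡⟨ cong (λ m → - (m * i)) (ℤ→ℚ-neg (+ suc n)) ⟨
      - (ℤ→ℚ -[1+ n ] * i)     ≡⟨ cong -_ z*i ⟩
      - ℕ→ℚ d                  ≡⟨ ℤ→ℚ-neg (+ d) ⟨
      ℤ→ℚ (ℤ.- + d)            ∎)
      where
      eq : ∀ m i → m * i ≡ - (- m * i)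
      eq = solve-∀ ℚ-ring

-- Signs and parity

neg-involutive : ∀ a → - - a ≡ a
neg-involutive = solve-∀ ℚ-ring

even⊎odd : ∀ n → (∃[ j ] n ≡ j ℕ.* 2) ⊎ (∃[ j ] n ≡ suc (j ℕ.* 2))
even⊎odd n with n divMod 2
... | result j fzero        eq = inj₁ (j , eq)
... | result j (fsuc fzero) eq = inj₂ (j , eq)

signQ-even : ∀ j → signQ (j ℕ.* 2) ≡ 1ℚ
signQ-even zero    = refl
signQ-even (suc j) = trans (neg-involutive (signQ (j ℕ.* 2))) (signQ-even j)

signQ-2∣ : ∀ {n} → 2 ∣ n → signQ n ≡ 1ℚ
signQ-2∣ (divides j refl) = signQ-even j

signQ-2∤ : ∀ {n} → ¬ 2 ∣ n → signQ n ≡ - 1ℚ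
signQ-2∤ {n} 2∤n with even⊎odd n
... | inj₁ (j , refl) = contradiction (divides j refl) 2∤n
... | inj₂ (j , refl) = cong -_ (signQ-even j)

-- G_p and G_{p-1} modulo an odd prime p = q + 1

module OddPrime {q : ℕ} (isPrime : Prime (suc q)) (odd : ¬ 2 ∣ suc q) where

  open Congruence isPrime

  p : ℕ
  p = suc q

  signQ-p : signQ p ≡ - 1ℚ
  signQ-p = signQ-2∤ odd

  signQ-q : signQ q ≡ 1ℚ
  signQ-q = trans (sym (neg-involutive (signQ q))) (cong -_ signQ-p)

  1-integral : Integral p 1ℚ
  1-integral = ℕ-integral 1

  -- Pascal's rule reduces to r = 0, where absorption leaves the factor C(p y - 1, p - 1) ≡ (-1)^(p-1) = 1.
  binomQ-p : ∀ r {y} → r < p → Integral p y → binomQ (ℕ→ℚ r + P * y) p ≈ y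
  binomQ-p zero {y} _ iy = ≈-trans (≡⇒≈ (*-cancelˡ P≢0 (begin
      P * binomQ z p                ≡⟨ cong (λ w → P * binomQ w p) (eq₁ z) ⟩
      P * binomQ (z - 1ℚ + 1ℚ) p    ≡⟨ binomQ-absorb (z - 1ℚ) q ⟩
      (z - 1ℚ + 1ℚ) * binomQ (z - 1ℚ) q ≡⟨ eq₂ P y (binomQ (z - 1ℚ) q) ⟩
      P * (y * binomQ (z - 1ℚ) q)   ∎)))
    (≈-trans (*-≈ iy 1-integral (≡⇒≈ refl) (≈-trans (binomQ-≈ q (ℕP.n<1+n q) (neg-integral 1-integral)
        (congruent y iy (eq₃ P y))) (≡⇒≈ (trans (binomQ--1 q) signQ-q))))
      (≡⇒≈ (ℚP.*-identityʳ y)))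
    where
    z = 0ℚ + P * y
    eq₁ : ∀ z → z ≡ z - 1ℚ + 1ℚ
    eq₁ = solve-∀ ℚ-ring
    eq₂ : ∀ P y b → (0ℚ + P * y - 1ℚ + 1ℚ) * b ≡ P * (y * b)
    eq₂ = solve-∀ ℚ-ring
    eq₃ : ∀ P y → 0ℚ + P * y - 1ℚ ≡ - 1ℚ + P * y
    eq₃ = solve-∀ ℚ-ring
  binomQ-p (suc r) {y} r<p iy = ≈-trans (≡⇒≈ (begin
      binomQ (ℕ→ℚ (suc r) + P * y) p    ≡⟨ cong (λ w → binomQ (w + P * y) p) (ℕ→ℚ-suc r) ⟩
      binomQ (ℕ→ℚ r + 1ℚ + P * y) p     ≡⟨ cong (λ w → binomQ w p) (eq (ℕ→ℚ r) (P * y)) ⟩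
      binomQ (z + 1ℚ) p                 ≡⟨ binomQ-pascal z q ⟩
      binomQ z p + binomQ z q           ∎))
    (≈-trans (+-≈ (binomQ-p r (ℕP.<⇒≤ r<p) iy)
      -- The second Pascal term is congruent to C(r,p-1), which is zero because r + 1 < p.
      (≈-trans (binomQ-≈ q (ℕP.n<1+n q) (ℕ-integral r) (congruent y iy refl))
               (≡⇒≈ (binomQ-vanish {r} {q} (ℕP.<⇒<′ (ℕ.s<s⁻¹ r<p))))))
      (≡⇒≈ (ℚP.+-identityʳ y)))
    where
    z = ℕ→ℚ r + P * y
    eq : ∀ a b → a + 1ℚ + b ≡ a + b + 1ℚ
    eq = solve-∀ ℚ-ring

  -- Here y is x'. Taking the decomposition as an equation lets the special values supply r and y
  -- directly.
  module _ {x y : ℚ} {r : ℕ} (iy : Integral p y) (r<p : r < p) (x≡ : x ≡ ℕ→ℚ r + P * y) where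

    private
      t : ℚ
      t = x * (x + 1ℚ)

    x-integral : Integral p x
    x-integral = subst (Integral p) (sym x≡) (+-integral (ℕ-integral r) (*-integral (ℕ-integral p) iy))

    x≈r : x ≈ ℕ→ℚ r
    x≈r = congruent y iy x≡

    reflected-integral : ∀ {z} → Integral p z → Integral p (- 1ℚ - z)
    reflected-integral = sub-integral (neg-integral 1-integral)

    coeff-integral : ∀ k → k < p → Integral p (coeff x k)
    coeff-integral k k<p = *-integral (*-integral (signQ-integral k) (binomQ-integral k k<p x-integral))
      (binomQ-integral k k<p (reflected-integral x-integral))

    -- The reflection x ↦ -1-x turns the pair (r, y) into (p-1-r, -1-y), so `binomQ-p` applies to
    -- both factors; together with the sign (-1)^p this gives -y(-1-y).
    coeff-p : coeff x p ≈ y * (y + 1ℚ)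
    coeff-p = ≈-trans (*-≈ (*-integral (neg-integral 1-integral) iy) (reflected-integral iy)
        (*-≈ (neg-integral 1-integral) iy (≡⇒≈ signQ-p) (≈-trans (≡⇒≈ (cong (λ w → binomQ w p) x≡)) (binomQ-p r r<p iy)))
        (≈-trans (≡⇒≈ (cong (λ w → binomQ w p) reflect)) (binomQ-p (q ℕ.∸ r) (ℕ.s≤s (ℕP.m∸n≤m q r)) (reflected-integral iy))))
      (≡⇒≈ (eq y))
      where
      eq : ∀ y → - 1ℚ * y * (- 1ℚ - y) ≡ y * (y + 1ℚ)
      eq = solve-∀ ℚ-ring
      P≡ : P ≡ ℕ→ℚ (q ℕ.∸ r) + ℕ→ℚ r + 1ℚ
      P≡ = trans (ℕ→ℚ-suc q) (cong (_+ 1ℚ) (trans (cong ℕ→ℚ (sym (ℕP.m∸n+n≡m (ℕ.s≤s⁻¹ r<p)))) (ℕ→ℚ-+ (q ℕ.∸ r) r)))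
      eq₁ : ∀ P r y → - 1ℚ - (r + P * y) ≡ P - r - 1ℚ + P * (- 1ℚ - y)
      eq₁ = solve-∀ ℚ-ring
      eq₂ : ∀ s r → s + r + 1ℚ - r - 1ℚ ≡ s
      eq₂ = solve-∀ ℚ-ring
      reflect : - 1ℚ - x ≡ ℕ→ℚ (q ℕ.∸ r) + P * (- 1ℚ - y)
      reflect = begin
        - 1ℚ - x                               ≡⟨ cong (λ w → - 1ℚ - w) x≡ ⟩
        - 1ℚ - (ℕ→ℚ r + P * y)                 ≡⟨ eq₁ P (ℕ→ℚ r) y ⟩
        P - ℕ→ℚ r - 1ℚ + P * (- 1ℚ - y)        ≡⟨ cong (λ w → w - ℕ→ℚ r - 1ℚ + P * (- 1ℚ - y)) P≡ ⟩
        ℕ→ℚ (q ℕ.∸ r) + ℕ→ℚ r + 1ℚ - ℕ→ℚ r - 1ℚ + P * (- 1ℚ - y) ≡⟨ cong (_+ P * (- 1ℚ - y)) (eq₂ (ℕ→ℚ (q ℕ.∸ r)) (ℕ→ℚ r)) ⟩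
        ℕ→ℚ (q ℕ.∸ r) + P * (- 1ℚ - y)         ∎

    -- By absorption (k+1) C(p,k+1) = p C(p-1,k), and k+1 is prime to p.
    binomQ-p-≈0 : ∀ k → suc k < p → binomQ P (suc k) ≈ 0ℚ
    binomQ-p-≈0 k k<p = cancel-≈ (∤-< k<p) (λ ())
      (congruent (binomQ (ℕ→ℚ q) k) (binomQ-integral k (ℕP.<⇒≤ k<p) (ℕ-integral q)) (begin
        ℕ→ℚ (suc k) * binomQ P (suc k)               ≡⟨ cong (λ w → ℕ→ℚ (suc k) * binomQ w (suc k)) (ℕ→ℚ-suc q) ⟩
        ℕ→ℚ (suc k) * binomQ (ℕ→ℚ q + 1ℚ) (suc k)    ≡⟨ binomQ-absorb (ℕ→ℚ q) k ⟩
        (ℕ→ℚ q + 1ℚ) * binomQ (ℕ→ℚ q) k              ≡⟨ cong (_* binomQ (ℕ→ℚ q) k) (ℕ→ℚ-suc q) ⟨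
        P * binomQ (ℕ→ℚ q) k                         ≡⟨ eq (ℕ→ℚ (suc k)) (P * binomQ (ℕ→ℚ q) k) ⟩
        ℕ→ℚ (suc k) * 0ℚ + P * binomQ (ℕ→ℚ q) k      ∎))
      where
      eq : ∀ k b → b ≡ k * 0ℚ + b
      eq = solve-∀ ℚ-ring

    -- C(p,k) ≡ 0 removes a term only if a_k is integral, which is known for k < p; the term k = p
    -- is left to `coeff-p`.
    Gν-p-≈1 : ∀ M → M < p → Gν (suc M) x P ≈ 1ℚ
    Gν-p-≈1 zero    _   = ≡⇒≈ refl
    Gν-p-≈1 (suc M) M<p = ≈-trans (≡⇒≈ (Gν-suc (suc M) x P)) (≈-trans
      (+-≈ (Gν-p-≈1 M (ℕP.<⇒≤ M<p)) (*-≈ (ℕ-integral 0) (coeff-integral (suc M) M<p) (binomQ-p-≈0 M M<p) (≡⇒≈ refl)))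
      (≡⇒≈ (eq (coeff x (suc M)))))
      where
      eq : ∀ a → 1ℚ + 0ℚ * a ≡ 1ℚ
      eq = solve-∀ ℚ-ring

    G-p-≈ : G p x ≈ 1ℚ + y * (y + 1ℚ)
    G-p-≈ = ≈-trans (≡⇒≈ (begin
        G p x                                ≡⟨ G≡Gν x (ℕP.n<1+n p) ⟩
        Gν (suc p) x P                       ≡⟨ Gν-suc p x P ⟩
        Gν p x P + binomQ P p * coeff x p    ≡⟨ cong (λ b → Gν p x P + b * coeff x p) (trans (sym (binomQ-ℕ p p)) (cong ℕ→ℚ (nCn≡1 p))) ⟩
        Gν p x P + 1ℚ * coeff x p            ≡⟨ cong (_+_ (Gν p x P)) (ℚP.*-identityˡ (coeff x p)) ⟩
        Gν p x P + coeff x p                 ∎))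
      (+-≈ (Gν-p-≈1 q (ℕP.n<1+n q)) coeff-p)

    -- From p - 1 ≡ -1 follows C(p-1,k) ≡ (-1)^k, which cancels the sign in a_k. Replacing x by r
    -- leaves the diagonal sum at r.
    G-q-≈ : G q x ≈ signQ r
    G-q-≈ = ≈-trans (≡⇒≈ (G≡Gν x (ℕP.n<1+n q))) (≈-trans (sum-≈ p term) (≡⇒≈ (diagonal-sum r (ℕ.s≤s⁻¹ r<p))))
      where
      q≈-1 : ℕ→ℚ q ≈ - 1ℚ
      q≈-1 = congruent 1ℚ 1-integral (trans (eq (ℕ→ℚ q)) (cong (λ w → - 1ℚ + w * 1ℚ) (sym (ℕ→ℚ-suc q))))
        where
        eq : ∀ n → n ≡ - 1ℚ + (n + 1ℚ) * 1ℚ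
        eq = solve-∀ ℚ-ring
      eq : ∀ s b c → s * (s * b * c) ≡ s * s * (b * c)
      eq = solve-∀ ℚ-ring
      term : ∀ k → k < p → binomQ (ℕ→ℚ q) k * coeff x k ≈ binomQ (ℕ→ℚ r) k * binomQ (- 1ℚ - ℕ→ℚ r) k
      term k k<p = ≈-trans (*-≈ (signQ-integral k)
          (*-integral (*-integral (signQ-integral k) b) c)
          (≈-trans (binomQ-≈ k k<p (neg-integral 1-integral) q≈-1) (≡⇒≈ (binomQ--1 k)))
          (*-≈ (*-integral (signQ-integral k) b) c
            (*-≈ (signQ-integral k) b (≡⇒≈ refl) (binomQ-≈ k k<p (ℕ-integral r) x≈r))
            (binomQ-≈ k k<p (reflected-integral (ℕ-integral r)) (+-≈ (≡⇒≈ { - 1ℚ} refl) (neg-≈ x≈r)))))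
        (≡⇒≈ (trans (eq (signQ k) (binomQ (ℕ→ℚ r) k) (binomQ (- 1ℚ - ℕ→ℚ r) k))
               (trans (cong (_* (binomQ (ℕ→ℚ r) k * binomQ (- 1ℚ - ℕ→ℚ r) k)) (signQ² k)) (ℚP.*-identityˡ _))))
        where
        b : Integral p (binomQ (ℕ→ℚ r) k)
        b = binomQ-integral k k<p (ℕ-integral r)
        c : Integral p (binomQ (- 1ℚ - ℕ→ℚ r) k)
        c = binomQ-integral k k<p (reflected-integral (ℕ-integral r))

    -- The value c is described by its product with D = t (t - 2), and D by an integral inverse i;
    -- the general quotient and the numerical constants both fit this form.
    sum-nG-congruence : ∀ {i c} → Integral p i → (x - 1ℚ) * x * (x + 1ℚ) * (x + ℕ→ℚ 2) * i ≡ 1ℚ →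
      (x - 1ℚ) * x * (x + 1ℚ) * (x + ℕ→ℚ 2) * c ≡ (1ℚ - t) * (1ℚ + y * (y + 1ℚ)) - signQ r →
      CongQ p 3 (sumQ p (λ n → ℕ→ℚ n * G n x)) (ℕ→ℚ (p ℕ.^ 2) * c)
    sum-nG-congruence {i} {c} ii Di Dc = conclude G-p-≈ G-q-≈
      where
      D = (x - 1ℚ) * x * (x + 1ℚ) * (x + ℕ→ℚ 2)
      S = sumQ p (λ n → ℕ→ℚ n * G n x)
      Y = y * (y + 1ℚ)
      t-integral : Integral p t
      t-integral = *-integral x-integral (+-integral x-integral 1-integral)
      P² : ℕ→ℚ (p ℕ.^ 2) ≡ P * P
      P² = trans (cong ℕ→ℚ (cong (p ℕ.*_) (ℕP.*-identityʳ p))) (ℕ→ℚ-* p p)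
      P³ : ℕ→ℚ (p ℕ.^ 3) ≡ P * (P * P)
      P³ = trans (ℕ→ℚ-* p (p ℕ.^ 2)) (cong (P *_) P²)
      conclude : G p x ≈ 1ℚ + Y → G q x ≈ signQ r → CongQ p 3 S (ℕ→ℚ (p ℕ.^ 2) * c)
      conclude (congruent u iu Gp) (congruent v iv Gq) =
        Integral⇒InZp (subst (Integral p) (sym quotient≡) (*-integral ii W-integral))
        where
        g = G p x
        g′ = G q x
        W : ℚ
        -- The total error divided by p³: u and v are the errors of G_p and G_{p-1}, and the last
        -- summand comes unchanged from the exact formula.
        W = (1ℚ - t) * u - v + t * (g - g′)
        W-integral : Integral p W
        W-integral = +-integral (sub-integral (*-integral (sub-integral 1-integral t-integral) iu) iv)
          (*-integral t-integral (sub-integral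
            -- Integrality of G_p is not visible from its definition, whose last term involves
            -- C(x,p); it is read off from the congruence.
            (subst (Integral p) (sym Gp) (+-integral (+-integral 1-integral (*-integral iy (+-integral iy 1-integral))) (*-integral (ℕ-integral p) iu)))
            (subst (Integral p) (sym Gq) (+-integral (signQ-integral r) (*-integral (ℕ-integral p) iv)))))
        eq₁ : ∀ D S P c → D * (S - P * P * c) ≡ D * S - P * P * (D * c)
        eq₁ = solve-∀ ℚ-ring
        -- The factor `1ℚ` on the right is the place where D i is substituted, so that D can be
        -- cancelled.
        eq₂ : ∀ P t Y u s v d → P * P * ((1ℚ - t) * (1ℚ + Y + P * u) - (s + P * v) + P * t * d) - P * P * ((1ℚ - t) * (1ℚ + Y) - s)
          ≡ 1ℚ * (P * (P * P) * ((1ℚ - t) * u - v + t * d))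
        eq₂ = solve-∀ ℚ-ring
        eq₃ : ∀ D i P W → D * i * (P * W) ≡ D * (P * (i * W))
        eq₃ = solve-∀ ℚ-ring
        D*difference : D * (S - P * P * c) ≡ D * (P * (P * P) * (i * W))
        D*difference = begin
          D * (S - P * P * c)                                                       ≡⟨ eq₁ D S P c ⟩
          D * S - P * P * (D * c)                                                   ≡⟨ cong₂ (λ a b → a - P * P * b) (sum-nG q x) Dc ⟩
          P * P * ((1ℚ - t) * g - g′ + P * t * (g - g′)) - P * P * ((1ℚ - t) * (1ℚ + Y) - signQ r)
            ≡⟨ cong₂ (λ a b → P * P * ((1ℚ - t) * a - b + P * t * (g - g′)) - P * P * ((1ℚ - t) * (1ℚ + Y) - signQ r)) Gp Gq ⟩
          P * P * ((1ℚ - t) * (1ℚ + Y + P * u) - (signQ r + P * v) + P * t * (g - g′)) - P * P * ((1ℚ - t) * (1ℚ + Y) - signQ r)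
            ≡⟨ eq₂ P t Y u (signQ r) v (g - g′) ⟩
          1ℚ * (P * (P * P) * W)                                                    ≡⟨ cong (_* (P * (P * P) * W)) Di ⟨
          D * i * (P * (P * P) * W)                                                 ≡⟨ eq₃ D i (P * (P * P)) W ⟩
          D * (P * (P * P) * (i * W))                                               ∎
        quotient≡ : (S - ℕ→ℚ (p ℕ.^ 2) * c) ÷' ℕ→ℚ (p ℕ.^ 3) ≡ i * W
        quotient≡ = trans (cong₂ (λ a b → (S - a * c) ÷' b) P² P³)
          (÷'-unique (*≢0 P≢0 (*≢0 P≢0 P≢0)) (sym (*-cancelˡ (unit≢0 {D} {i} Di) D*difference)))

-- Integral forms of G at x = -1/m

C-! : ∀ a b → ((a ℕ.+ b) C a) ℕ.* (a ! ℕ.* b !) ≡ (a ℕ.+ b) !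
C-! a b = begin
  ((a ℕ.+ b) C a) ℕ.* (a ! ℕ.* b !)                       ≡⟨ cong (λ z → ((a ℕ.+ b) C a) ℕ.* (a ! ℕ.* z !)) (ℕP.m+n∸m≡n a b) ⟨
  ((a ℕ.+ b) C a) ℕ.* (a ! ℕ.* (a ℕ.+ b ℕ.∸ a) !)         ≡⟨ cong (ℕ._* (a ! ℕ.* (a ℕ.+ b ℕ.∸ a) !)) (nCk≡n!/k![n-k]! (ℕP.m≤m+n a b)) ⟩
  _                                                       ≡⟨ m/n*n≡m {{a ℕP.!* (a ℕ.+ b ℕ.∸ a) !≢0}} (k![n∸k]!∣n! (ℕP.m≤m+n a b)) ⟩
  (a ℕ.+ b) !                                             ∎

2k : ∀ k → ((2 ℕ.* k) C k) ℕ.* (k ! ℕ.* k !) ≡ (2 ℕ.* k) !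
2k k = subst (λ n → (n C k) ℕ.* (k ! ℕ.* k !) ≡ n !) (eq k) (C-! k k)
  where
  eq : ∀ k → k ℕ.+ k ≡ 2 ℕ.* k
  eq = ℕSolver.solve-∀

3k : ∀ k → ((3 ℕ.* k) C k) ℕ.* (k ! ℕ.* (2 ℕ.* k) !) ≡ (3 ℕ.* k) !
3k k = C-! k (2 ℕ.* k)

4k : ∀ k → ((4 ℕ.* k) C (2 ℕ.* k)) ℕ.* ((2 ℕ.* k) ! ℕ.* (2 ℕ.* k) !) ≡ (4 ℕ.* k) !
4k k = subst (λ n → (n C (2 ℕ.* k)) ℕ.* ((2 ℕ.* k) ! ℕ.* (2 ℕ.* k) !) ≡ n !) (eq k) (C-! (2 ℕ.* k) (2 ℕ.* k))
  where
  eq : ∀ k → 2 ℕ.* k ℕ.+ 2 ℕ.* k ≡ 4 ℕ.* k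
  eq = ℕSolver.solve-∀

6k : ∀ k → ((6 ℕ.* k) C (3 ℕ.* k)) ℕ.* ((3 ℕ.* k) ! ℕ.* (3 ℕ.* k) !) ≡ (6 ℕ.* k) !
6k k = subst (λ n → (n C (3 ℕ.* k)) ℕ.* ((3 ℕ.* k) ! ℕ.* (3 ℕ.* k) !) ≡ n !) (eq k) (C-! (3 ℕ.* k) (3 ℕ.* k))
  where
  eq : ∀ k → 3 ℕ.* k ℕ.+ 3 ℕ.* k ≡ 6 ℕ.* k
  eq = ℕSolver.solve-∀

-- c k (-1)^k / B^k, with B = b m², is the coefficient at x = -1/m; only the ratio of consecutive terms matters.
CoefficientRatio : (m-1 b : ℕ) → (ℕ → ℕ) → Set
CoefficientRatio m-1 b c = ∀ k → suc k ℕ.* suc k ℕ.* c (suc k) ≡ b ℕ.* ((suc m-1 ℕ.* k ℕ.+ 1) ℕ.* (suc m-1 ℕ.* k ℕ.+ m-1)) ℕ.* c k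

-- From c = h/f: passing to k+1 multiplies h by w e and f by (k+1)² e, and the common factor e
-- cancels.
factorial-ratio : ∀ (c f h : ℕ → ℕ) → (∀ k → c k ℕ.* f k ≡ h k) → ∀ k w e .{{_ : ℕ.NonZero e}} .{{_ : ℕ.NonZero (f k)}} →
  f (suc k) ≡ suc k ℕ.* suc k ℕ.* e ℕ.* f k → h (suc k) ≡ w ℕ.* e ℕ.* h k → suc k ℕ.* suc k ℕ.* c (suc k) ≡ w ℕ.* c k
factorial-ratio c f h closed k w e f-suc h-suc = ℕP.*-cancelʳ-≡ _ _ (e ℕ.* f k) {{ℕP.m*n≢0 e (f k)}} (begin
  s ℕ.* c (suc k) ℕ.* (e ℕ.* f k)   ≡⟨ eq₁ s (c (suc k)) e (f k) ⟩
  c (suc k) ℕ.* (s ℕ.* e ℕ.* f k)   ≡⟨ cong (c (suc k) ℕ.*_) f-suc ⟨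
  c (suc k) ℕ.* f (suc k)           ≡⟨ closed (suc k) ⟩
  h (suc k)                         ≡⟨ h-suc ⟩
  w ℕ.* e ℕ.* h k                   ≡⟨ cong (w ℕ.* e ℕ.*_) (closed k) ⟨
  w ℕ.* e ℕ.* (c k ℕ.* f k)         ≡⟨ eq₂ w e (c k) (f k) ⟩
  w ℕ.* c k ℕ.* (e ℕ.* f k)         ∎)
  where
  s = suc k ℕ.* suc k
  eq₁ : ∀ s c e f → s ℕ.* c ℕ.* (e ℕ.* f) ≡ c ℕ.* (s ℕ.* e ℕ.* f)
  eq₁ = ℕSolver.solve-∀
  eq₂ : ∀ w e c f → w ℕ.* e ℕ.* (c ℕ.* f) ≡ w ℕ.* c ℕ.* (e ℕ.* f)
  eq₂ = ℕSolver.solve-∀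

c₂ c₃ c₄ c₆ : ℕ → ℕ
c₂ k = ((2 ℕ.* k) C k) ℕ.^ 2
c₃ k = ((2 ℕ.* k) C k) ℕ.* ((3 ℕ.* k) C k)
c₄ k = ((2 ℕ.* k) C k) ℕ.* ((4 ℕ.* k) C (2 ℕ.* k))
c₆ k = ((3 ℕ.* k) C k) ℕ.* ((6 ℕ.* k) C (3 ℕ.* k))

-- The coefficient is (2k)!²/k!⁴. In this and the next ratios b collects the constants by which new
-- factors of the numerator exceed those of the denominator: here (2k+2)² = 4(k+1)².
ratio₂ : CoefficientRatio 1 4 c₂
ratio₂ k = factorial-ratio c₂ f h closed k (4 ℕ.* ((2 ℕ.* k ℕ.+ 1) ℕ.* (2 ℕ.* k ℕ.+ 1))) (suc k ℕ.* suc k) {{_}} {{f≢0}}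
  (eq₁ k (k !)) (trans (cong (λ n → n ! ℕ.* n !) (ℕP.*-suc 2 k)) (eq₂ k ((2 ℕ.* k) !)))
  where
  f h : ℕ → ℕ
  f k = k ! ℕ.* k ! ℕ.* (k ! ℕ.* k !)
  h k = (2 ℕ.* k) ! ℕ.* (2 ℕ.* k) !
  f≢0 : ℕ.NonZero (f k)
  f≢0 = ℕP.m*n≢0 _ _ {{k ℕP.!* k !≢0}} {{k ℕP.!* k !≢0}}
  eq : ∀ a f → a ℕ.* (a ℕ.* 1) ℕ.* (f ℕ.* f) ≡ a ℕ.* f ℕ.* (a ℕ.* f)
  eq = ℕSolver.solve-∀
  closed : ∀ k → c₂ k ℕ.* f k ≡ h k
  closed k = trans (eq ((2 ℕ.* k) C k) (k ! ℕ.* k !)) (cong₂ ℕ._*_ (2k k) (2k k))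
  eq₁ : ∀ k f → suc k ℕ.* f ℕ.* (suc k ℕ.* f) ℕ.* (suc k ℕ.* f ℕ.* (suc k ℕ.* f)) ≡ suc k ℕ.* suc k ℕ.* (suc k ℕ.* suc k) ℕ.* (f ℕ.* f ℕ.* (f ℕ.* f))
  eq₁ = ℕSolver.solve-∀
  eq₂ : ∀ k h → (2 ℕ.+ 2 ℕ.* k) ℕ.* ((1 ℕ.+ 2 ℕ.* k) ℕ.* h) ℕ.* ((2 ℕ.+ 2 ℕ.* k) ℕ.* ((1 ℕ.+ 2 ℕ.* k) ℕ.* h))
    ≡ 4 ℕ.* ((2 ℕ.* k ℕ.+ 1) ℕ.* (2 ℕ.* k ℕ.+ 1)) ℕ.* (suc k ℕ.* suc k) ℕ.* (h ℕ.* h)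
  eq₂ = ℕSolver.solve-∀

ratio₃ : CoefficientRatio 2 3 c₃
ratio₃ k = factorial-ratio c₃ f h closed k (3 ℕ.* ((3 ℕ.* k ℕ.+ 1) ℕ.* (3 ℕ.* k ℕ.+ 2))) (suc k) {{_}} {{f≢0}}
  (eq₁ k (k !)) (trans (cong _! (ℕP.*-suc 3 k)) (eq₂ k ((3 ℕ.* k) !)))
  where
  f h : ℕ → ℕ
  f k = k ! ℕ.* k ! ℕ.* k !
  h k = (3 ℕ.* k) !
  f≢0 : ℕ.NonZero (f k)
  f≢0 = ℕP.m*n≢0 _ _ {{k ℕP.!* k !≢0}} {{k ℕP.!≢0}}
  eq : ∀ a b f → a ℕ.* b ℕ.* (f ℕ.* f ℕ.* f) ≡ a ℕ.* (f ℕ.* f) ℕ.* (b ℕ.* f)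
  eq = ℕSolver.solve-∀
  eq′ : ∀ g b f → g ℕ.* (b ℕ.* f) ≡ b ℕ.* (f ℕ.* g)
  eq′ = ℕSolver.solve-∀
  closed : ∀ k → c₃ k ℕ.* f k ≡ h k
  closed k = begin
    _                                                        ≡⟨ eq ((2 ℕ.* k) C k) ((3 ℕ.* k) C k) (k !) ⟩
    ((2 ℕ.* k) C k) ℕ.* (k ! ℕ.* k !) ℕ.* (((3 ℕ.* k) C k) ℕ.* k !) ≡⟨ cong (ℕ._* (((3 ℕ.* k) C k) ℕ.* k !)) (2k k) ⟩
    (2 ℕ.* k) ! ℕ.* (((3 ℕ.* k) C k) ℕ.* k !)                ≡⟨ eq′ ((2 ℕ.* k) !) ((3 ℕ.* k) C k) (k !) ⟩
    ((3 ℕ.* k) C k) ℕ.* (k ! ℕ.* (2 ℕ.* k) !)                ≡⟨ 3k k ⟩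
    (3 ℕ.* k) !                                              ∎
  eq₁ : ∀ k f → suc k ℕ.* f ℕ.* (suc k ℕ.* f) ℕ.* (suc k ℕ.* f) ≡ suc k ℕ.* suc k ℕ.* suc k ℕ.* (f ℕ.* f ℕ.* f)
  eq₁ = ℕSolver.solve-∀
  eq₂ : ∀ k h → (3 ℕ.+ 3 ℕ.* k) ℕ.* ((2 ℕ.+ 3 ℕ.* k) ℕ.* ((1 ℕ.+ 3 ℕ.* k) ℕ.* h))
    ≡ 3 ℕ.* ((3 ℕ.* k ℕ.+ 1) ℕ.* (3 ℕ.* k ℕ.+ 2)) ℕ.* suc k ℕ.* h
  eq₂ = ℕSolver.solve-∀

ratio₄ : CoefficientRatio 3 4 c₄
ratio₄ k = factorial-ratio c₄ f h closed k (4 ℕ.* ((4 ℕ.* k ℕ.+ 1) ℕ.* (4 ℕ.* k ℕ.+ 3))) ((2 ℕ.+ 2 ℕ.* k) ℕ.* (1 ℕ.+ 2 ℕ.* k)) {{_}} {{f≢0}}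
  (trans (cong (λ n → suc k ! ℕ.* suc k ! ℕ.* n !) (ℕP.*-suc 2 k)) (eq₁ k (k !) ((2 ℕ.* k) !)))
  (trans (cong _! (ℕP.*-suc 4 k)) (eq₂ k ((4 ℕ.* k) !)))
  where
  f h : ℕ → ℕ
  f k = k ! ℕ.* k ! ℕ.* (2 ℕ.* k) !
  h k = (4 ℕ.* k) !
  f≢0 : ℕ.NonZero (f k)
  f≢0 = ℕP.m*n≢0 _ _ {{k ℕP.!* k !≢0}} {{(2 ℕ.* k) ℕP.!≢0}}
  eq : ∀ a b f g → a ℕ.* b ℕ.* (f ℕ.* f ℕ.* g) ≡ a ℕ.* (f ℕ.* f) ℕ.* (b ℕ.* g)
  eq = ℕSolver.solve-∀
  eq′ : ∀ b g → g ℕ.* (b ℕ.* g) ≡ b ℕ.* (g ℕ.* g)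
  eq′ = ℕSolver.solve-∀
  closed : ∀ k → c₄ k ℕ.* f k ≡ h k
  closed k = begin
    _                                                        ≡⟨ eq ((2 ℕ.* k) C k) ((4 ℕ.* k) C (2 ℕ.* k)) (k !) ((2 ℕ.* k) !) ⟩
    ((2 ℕ.* k) C k) ℕ.* (k ! ℕ.* k !) ℕ.* (((4 ℕ.* k) C (2 ℕ.* k)) ℕ.* (2 ℕ.* k) !) ≡⟨ cong (ℕ._* (((4 ℕ.* k) C (2 ℕ.* k)) ℕ.* (2 ℕ.* k) !)) (2k k) ⟩
    (2 ℕ.* k) ! ℕ.* (((4 ℕ.* k) C (2 ℕ.* k)) ℕ.* (2 ℕ.* k) !) ≡⟨ eq′ ((4 ℕ.* k) C (2 ℕ.* k)) ((2 ℕ.* k) !) ⟩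
    ((4 ℕ.* k) C (2 ℕ.* k)) ℕ.* ((2 ℕ.* k) ! ℕ.* (2 ℕ.* k) !) ≡⟨ 4k k ⟩
    (4 ℕ.* k) !                                              ∎
  eq₁ : ∀ k f g → suc k ℕ.* f ℕ.* (suc k ℕ.* f) ℕ.* ((2 ℕ.+ 2 ℕ.* k) ℕ.* ((1 ℕ.+ 2 ℕ.* k) ℕ.* g))
    ≡ suc k ℕ.* suc k ℕ.* ((2 ℕ.+ 2 ℕ.* k) ℕ.* (1 ℕ.+ 2 ℕ.* k)) ℕ.* (f ℕ.* f ℕ.* g)
  eq₁ = ℕSolver.solve-∀
  eq₂ : ∀ k h → (4 ℕ.+ 4 ℕ.* k) ℕ.* ((3 ℕ.+ 4 ℕ.* k) ℕ.* ((2 ℕ.+ 4 ℕ.* k) ℕ.* ((1 ℕ.+ 4 ℕ.* k) ℕ.* h)))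
    ≡ 4 ℕ.* ((4 ℕ.* k ℕ.+ 1) ℕ.* (4 ℕ.* k ℕ.+ 3)) ℕ.* ((2 ℕ.+ 2 ℕ.* k) ℕ.* (1 ℕ.+ 2 ℕ.* k)) ℕ.* h
  eq₂ = ℕSolver.solve-∀

-- The coefficient is (6k)!/(k! (2k)! (3k)!). Of the six new factors above, 6k+2, 6k+4, 6k+6 are
-- twice 3k+1, 3k+2, 3k+3, and 6k+3 is three times 2k+1; the constant 24 splits as 12 times the 2
-- coming from 2k+2 = 2(k+1).
ratio₆ : CoefficientRatio 5 12 c₆
ratio₆ k = factorial-ratio c₆ f h closed k (12 ℕ.* ((6 ℕ.* k ℕ.+ 1) ℕ.* (6 ℕ.* k ℕ.+ 5)))
  (2 ℕ.* ((1 ℕ.+ 2 ℕ.* k) ℕ.* ((1 ℕ.+ 3 ℕ.* k) ℕ.* ((2 ℕ.+ 3 ℕ.* k) ℕ.* (3 ℕ.+ 3 ℕ.* k))))) {{_}} {{f≢0}}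
  (trans (cong₂ (λ m n → suc k ! ℕ.* m ! ℕ.* n !) (ℕP.*-suc 2 k) (ℕP.*-suc 3 k)) (eq₁ k (k !) ((2 ℕ.* k) !) ((3 ℕ.* k) !)))
  (trans (cong _! (ℕP.*-suc 6 k)) (eq₂ k ((6 ℕ.* k) !)))
  where
  f h : ℕ → ℕ
  f k = k ! ℕ.* (2 ℕ.* k) ! ℕ.* (3 ℕ.* k) !
  h k = (6 ℕ.* k) !
  f≢0 : ℕ.NonZero (f k)
  f≢0 = ℕP.m*n≢0 _ _ {{k ℕP.!* (2 ℕ.* k) !≢0}} {{(3 ℕ.* k) ℕP.!≢0}}
  eq : ∀ a b f g h → a ℕ.* b ℕ.* (f ℕ.* g ℕ.* h) ≡ a ℕ.* (f ℕ.* g) ℕ.* (b ℕ.* h)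
  eq = ℕSolver.solve-∀
  eq′ : ∀ b g → g ℕ.* (b ℕ.* g) ≡ b ℕ.* (g ℕ.* g)
  eq′ = ℕSolver.solve-∀
  closed : ∀ k → c₆ k ℕ.* f k ≡ h k
  closed k = begin
    _                                                        ≡⟨ eq ((3 ℕ.* k) C k) ((6 ℕ.* k) C (3 ℕ.* k)) (k !) ((2 ℕ.* k) !) ((3 ℕ.* k) !) ⟩
    ((3 ℕ.* k) C k) ℕ.* (k ! ℕ.* (2 ℕ.* k) !) ℕ.* (((6 ℕ.* k) C (3 ℕ.* k)) ℕ.* (3 ℕ.* k) !) ≡⟨ cong (ℕ._* (((6 ℕ.* k) C (3 ℕ.* k)) ℕ.* (3 ℕ.* k) !)) (3k k) ⟩
    (3 ℕ.* k) ! ℕ.* (((6 ℕ.* k) C (3 ℕ.* k)) ℕ.* (3 ℕ.* k) !) ≡⟨ eq′ ((6 ℕ.* k) C (3 ℕ.* k)) ((3 ℕ.* k) !) ⟩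
    ((6 ℕ.* k) C (3 ℕ.* k)) ℕ.* ((3 ℕ.* k) ! ℕ.* (3 ℕ.* k) !) ≡⟨ 6k k ⟩
    (6 ℕ.* k) !                                              ∎
  eq₁ : ∀ k f g h → suc k ℕ.* f ℕ.* ((2 ℕ.+ 2 ℕ.* k) ℕ.* ((1 ℕ.+ 2 ℕ.* k) ℕ.* g)) ℕ.* ((3 ℕ.+ 3 ℕ.* k) ℕ.* ((2 ℕ.+ 3 ℕ.* k) ℕ.* ((1 ℕ.+ 3 ℕ.* k) ℕ.* h)))
    ≡ suc k ℕ.* suc k ℕ.* (2 ℕ.* ((1 ℕ.+ 2 ℕ.* k) ℕ.* ((1 ℕ.+ 3 ℕ.* k) ℕ.* ((2 ℕ.+ 3 ℕ.* k) ℕ.* (3 ℕ.+ 3 ℕ.* k))))) ℕ.* (f ℕ.* g ℕ.* h)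
  eq₁ = ℕSolver.solve-∀
  eq₂ : ∀ k h → (6 ℕ.+ 6 ℕ.* k) ℕ.* ((5 ℕ.+ 6 ℕ.* k) ℕ.* ((4 ℕ.+ 6 ℕ.* k) ℕ.* ((3 ℕ.+ 6 ℕ.* k) ℕ.* ((2 ℕ.+ 6 ℕ.* k) ℕ.* ((1 ℕ.+ 6 ℕ.* k) ℕ.* h)))))
    ≡ 12 ℕ.* ((6 ℕ.* k ℕ.+ 1) ℕ.* (6 ℕ.* k ℕ.+ 5)) ℕ.* (2 ℕ.* ((1 ℕ.+ 2 ℕ.* k) ℕ.* ((1 ℕ.+ 3 ℕ.* k) ℕ.* ((2 ℕ.+ 3 ℕ.* k) ℕ.* (3 ℕ.+ 3 ℕ.* k))))) ℕ.* h
  eq₂ = ℕSolver.solve-∀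

-- Because m x = -1, m(k-x) = mk+1 and m(k+1+x) = mk+m-1. So both sides start at 1 and obey the
-- recurrence expressed by `CoefficientRatio`.
binomQ-product : ∀ m-1 b c {x} → c 0 ≡ 1 → CoefficientRatio m-1 b c → ℕ→ℚ (suc m-1) * x ≡ - 1ℚ →
  ∀ k → ℕ→ℚ ((b ℕ.* (suc m-1 ℕ.* suc m-1)) ℕ.^ k) * (binomQ x k * binomQ (- 1ℚ - x) k) ≡ ℕ→ℚ (c k)
binomQ-product m-1 b c c0 ratio mx zero = sym (cong ℕ→ℚ c0)
binomQ-product m-1 b c {x} c0 ratio mx (suc k) = *-cancelˡ (*≢0 (ℕ→ℚ≢0 (suc k)) (ℕ→ℚ≢0 (suc k))) (begin
  K * K * (ℕ→ℚ (B ℕ.* B ℕ.^ k) * (binomQ x (suc k) * binomQ y (suc k)))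
    ≡⟨ cong (λ z → K * K * (z * (binomQ x (suc k) * binomQ y (suc k)))) (ℕ→ℚ-* B (B ℕ.^ k)) ⟩
  K * K * (ℕ→ℚ B * Bᵏ * (binomQ x (suc k) * binomQ y (suc k)))
    ≡⟨ eq₁ K (ℕ→ℚ B) Bᵏ (binomQ x (suc k)) (binomQ y (suc k)) ⟩
  ℕ→ℚ B * Bᵏ * (K * binomQ x (suc k)) * (K * binomQ y (suc k))
    ≡⟨ cong₂ (λ u v → ℕ→ℚ B * Bᵏ * u * v) (binomQ-suc x k) (binomQ-suc y k) ⟩
  ℕ→ℚ B * Bᵏ * (binomQ x k * (x - ℕ→ℚ k)) * (binomQ y k * (y - ℕ→ℚ k))
    ≡⟨ eq₂ (ℕ→ℚ B) Bᵏ (binomQ x k) (x - ℕ→ℚ k) (binomQ y k) (y - ℕ→ℚ k) ⟩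
  ℕ→ℚ B * ((x - ℕ→ℚ k) * (y - ℕ→ℚ k)) * (Bᵏ * (binomQ x k * binomQ y k))
    ≡⟨ cong₂ _*_ factor (binomQ-product m-1 b c c0 ratio mx k) ⟩
  ℕ→ℚ (b ℕ.* ((m ℕ.* k ℕ.+ 1) ℕ.* (m ℕ.* k ℕ.+ m-1))) * ℕ→ℚ (c k) ≡⟨ ℕ→ℚ-* (b ℕ.* ((m ℕ.* k ℕ.+ 1) ℕ.* (m ℕ.* k ℕ.+ m-1))) (c k) ⟨
  ℕ→ℚ (b ℕ.* ((m ℕ.* k ℕ.+ 1) ℕ.* (m ℕ.* k ℕ.+ m-1)) ℕ.* c k)     ≡⟨ cong ℕ→ℚ (ratio k) ⟨
  ℕ→ℚ (suc k ℕ.* suc k ℕ.* c (suc k))                             ≡⟨ ℕ→ℚ-* (suc k ℕ.* suc k) (c (suc k)) ⟩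
  ℕ→ℚ (suc k ℕ.* suc k) * ℕ→ℚ (c (suc k))                         ≡⟨ cong (_* ℕ→ℚ (c (suc k))) (ℕ→ℚ-* (suc k) (suc k)) ⟩
  K * K * ℕ→ℚ (c (suc k))                                         ∎)
  where
  m  = suc m-1
  B  = b ℕ.* (m ℕ.* m)
  K  = ℕ→ℚ (suc k)
  y  = - 1ℚ - x
  Bᵏ = ℕ→ℚ (B ℕ.^ k)
  M  = ℕ→ℚ m
  eq₁ : ∀ K B C u v → K * K * (B * C * (u * v)) ≡ B * C * (K * u) * (K * v)
  eq₁ = solve-∀ ℚ-ring
  eq₂ : ∀ B C u v w z → B * C * (u * v) * (w * z) ≡ B * (v * z) * (C * (u * w))
  eq₂ = solve-∀ ℚ-ring
  -- The product m x is isolated so that it can be replaced by -1; the last bracket m x + 1 then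
  -- disappears.
  eq₃ : ∀ β n x k → β * ((n + 1ℚ) * (n + 1ℚ)) * ((x - k) * (- 1ℚ - x - k)) ≡ β * (((n + 1ℚ) * k - (n + 1ℚ) * x) * ((n + 1ℚ) * k + n + ((n + 1ℚ) * x + 1ℚ)))
  eq₃ = solve-∀ ℚ-ring
  eq₄ : ∀ β n z → β * ((z - - 1ℚ) * (z + n + (- 1ℚ + 1ℚ))) ≡ β * ((z + 1ℚ) * (z + n))
  eq₄ = solve-∀ ℚ-ring
  mk+ : ∀ n → ℕ→ℚ (m ℕ.* k ℕ.+ n) ≡ M * ℕ→ℚ k + ℕ→ℚ n
  mk+ n = trans (ℕ→ℚ-+ (m ℕ.* k) n) (cong (_+ ℕ→ℚ n) (ℕ→ℚ-* m k))
  factor : ℕ→ℚ B * ((x - ℕ→ℚ k) * (y - ℕ→ℚ k)) ≡ ℕ→ℚ (b ℕ.* ((m ℕ.* k ℕ.+ 1) ℕ.* (m ℕ.* k ℕ.+ m-1)))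
  factor = begin
    ℕ→ℚ B * ((x - ℕ→ℚ k) * (y - ℕ→ℚ k))
      ≡⟨ cong (_* ((x - ℕ→ℚ k) * (y - ℕ→ℚ k))) (trans (ℕ→ℚ-* b (m ℕ.* m)) (cong (ℕ→ℚ b *_) (trans (ℕ→ℚ-* m m) (cong (λ z → z * z) (ℕ→ℚ-suc m-1))))) ⟩
    _ ≡⟨ eq₃ (ℕ→ℚ b) (ℕ→ℚ m-1) x (ℕ→ℚ k) ⟩
    _ ≡⟨ cong (λ z → ℕ→ℚ b * ((z * ℕ→ℚ k - z * x) * (z * ℕ→ℚ k + ℕ→ℚ m-1 + (z * x + 1ℚ)))) (ℕ→ℚ-suc m-1) ⟨
    ℕ→ℚ b * ((M * ℕ→ℚ k - M * x) * (M * ℕ→ℚ k + ℕ→ℚ m-1 + (M * x + 1ℚ)))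
      ≡⟨ cong (λ z → ℕ→ℚ b * ((M * ℕ→ℚ k - z) * (M * ℕ→ℚ k + ℕ→ℚ m-1 + (z + 1ℚ)))) mx ⟩
    ℕ→ℚ b * ((M * ℕ→ℚ k - - 1ℚ) * (M * ℕ→ℚ k + ℕ→ℚ m-1 + (- 1ℚ + 1ℚ))) ≡⟨ eq₄ (ℕ→ℚ b) (ℕ→ℚ m-1) (M * ℕ→ℚ k) ⟩
    ℕ→ℚ b * ((M * ℕ→ℚ k + 1ℚ) * (M * ℕ→ℚ k + ℕ→ℚ m-1)) ≡⟨ cong₂ (λ u v → ℕ→ℚ b * (u * v)) (mk+ 1) (mk+ m-1) ⟨
    ℕ→ℚ b * (ℕ→ℚ (m ℕ.* k ℕ.+ 1) * ℕ→ℚ (m ℕ.* k ℕ.+ m-1)) ≡⟨ cong (ℕ→ℚ b *_) (ℕ→ℚ-* (m ℕ.* k ℕ.+ 1) (m ℕ.* k ℕ.+ m-1)) ⟨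
    ℕ→ℚ b * ℕ→ℚ ((m ℕ.* k ℕ.+ 1) ℕ.* (m ℕ.* k ℕ.+ m-1)) ≡⟨ ℕ→ℚ-* b ((m ℕ.* k ℕ.+ 1) ℕ.* (m ℕ.* k ℕ.+ m-1)) ⟨
    ℕ→ℚ (b ℕ.* ((m ℕ.* k ℕ.+ 1) ℕ.* (m ℕ.* k ℕ.+ m-1))) ∎

ℤ→ℚ-signℤ : ∀ k → ℤ→ℚ (signℤ k) ≡ signQ k
ℤ→ℚ-signℤ zero    = refl
ℤ→ℚ-signℤ (suc k) = trans (ℤ→ℚ-neg (signℤ k)) (cong -_ (ℤ→ℚ-signℤ k))

-- `G2`, `G3`, `G4` and `G6` are instances by mere unfolding, with B = b m² equal to 16, 27, 64 and
-- 432.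
Gℤ : ℕ → (ℕ → ℕ) → ℕ → ℤ
Gℤ B c n = sumℤ (suc n) (λ k → + (n C k) ℤ.* signℤ k ℤ.* + (c k) ℤ.* + (B ℕ.^ (n ℕ.∸ k)))

Gℤ≡G : ∀ {B c x} → (∀ k → ℕ→ℚ (B ℕ.^ k) * (binomQ x k * binomQ (- 1ℚ - x) k) ≡ ℕ→ℚ (c k)) →
  ∀ n → ℕ→ℚ (B ℕ.^ n) * G n x ≡ ℤ→ℚ (Gℤ B c n)
Gℤ≡G {B} {c} {x} product n = begin
  ℕ→ℚ (B ℕ.^ n) * G n x
    ≡⟨ sumQ-*ˡ (suc n) (ℕ→ℚ (B ℕ.^ n)) (λ k → ℕ→ℚ (n C k) * signQ k * binomQ x k * binomQ (- 1ℚ - x) k) ⟩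
  sumQ (suc n) (λ k → ℕ→ℚ (B ℕ.^ n) * (ℕ→ℚ (n C k) * signQ k * binomQ x k * binomQ (- 1ℚ - x) k))
    ≡⟨ sumQ-cong (suc n) term ⟩
  sumQ (suc n) (λ k → ℤ→ℚ (+ (n C k) ℤ.* signℤ k ℤ.* + (c k) ℤ.* + (B ℕ.^ (n ℕ.∸ k))))
    ≡⟨ ℤ→ℚ-sumℤ (suc n) (λ k → + (n C k) ℤ.* signℤ k ℤ.* + (c k) ℤ.* + (B ℕ.^ (n ℕ.∸ k))) ⟨
  ℤ→ℚ (Gℤ B c n) ∎
  where
  eq : ∀ p q n s b d → p * q * (n * s * b * d) ≡ n * s * (p * (b * d)) * q
  eq = solve-∀ ℚ-ring
  term : ∀ k → k < suc n → ℕ→ℚ (B ℕ.^ n) * (ℕ→ℚ (n C k) * signQ k * binomQ x k * binomQ (- 1ℚ - x) k)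
    ≡ ℤ→ℚ (+ (n C k) ℤ.* signℤ k ℤ.* + (c k) ℤ.* + (B ℕ.^ (n ℕ.∸ k)))
  term k k≤n = begin
    ℕ→ℚ (B ℕ.^ n) * (N * signQ k * binomQ x k * binomQ (- 1ℚ - x) k)
      ≡⟨ cong (_* (N * signQ k * binomQ x k * binomQ (- 1ℚ - x) k)) (trans (cong ℕ→ℚ power) (ℕ→ℚ-* (B ℕ.^ k) (B ℕ.^ (n ℕ.∸ k)))) ⟩
    ℕ→ℚ (B ℕ.^ k) * R * (N * signQ k * binomQ x k * binomQ (- 1ℚ - x) k)
      ≡⟨ eq (ℕ→ℚ (B ℕ.^ k)) R N (signQ k) (binomQ x k) (binomQ (- 1ℚ - x) k) ⟩
    N * signQ k * (ℕ→ℚ (B ℕ.^ k) * (binomQ x k * binomQ (- 1ℚ - x) k)) * R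
      ≡⟨ cong₂ (λ u v → N * u * v * R) (sym (ℤ→ℚ-signℤ k)) (product k) ⟩
    N * ℤ→ℚ (signℤ k) * ℕ→ℚ (c k) * R                    ≡⟨ cong (λ z → z * ℕ→ℚ (c k) * R) (ℤ→ℚ-* (+ (n C k)) (signℤ k)) ⟨
    ℤ→ℚ (+ (n C k) ℤ.* signℤ k) * ℕ→ℚ (c k) * R          ≡⟨ cong (_* R) (ℤ→ℚ-* (+ (n C k) ℤ.* signℤ k) (+ (c k))) ⟨
    ℤ→ℚ (+ (n C k) ℤ.* signℤ k ℤ.* + (c k)) * R          ≡⟨ ℤ→ℚ-* (+ (n C k) ℤ.* signℤ k ℤ.* + (c k)) (+ (B ℕ.^ (n ℕ.∸ k))) ⟨
    ℤ→ℚ (+ (n C k) ℤ.* signℤ k ℤ.* + (c k) ℤ.* + (B ℕ.^ (n ℕ.∸ k))) ∎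
    where
    N = ℕ→ℚ (n C k)
    R = ℕ→ℚ (B ℕ.^ (n ℕ.∸ k))
    power : B ℕ.^ n ≡ B ℕ.^ k ℕ.* B ℕ.^ (n ℕ.∸ k)
    power = trans (cong (B ℕ.^_) (sym (ℕP.m+[n∸m]≡n (ℕ.s≤s⁻¹ k≤n)))) (ℕP.^-distribˡ-+-* B k (n ℕ.∸ k))

-- The congruence at x = -1/m

module SpecialValue (m-1 b : ℕ) .{{_ : ℕ.NonZero b}} (c : ℕ → ℕ) (x i : ℚ)
  (c0 : c 0 ≡ 1) (ratio : CoefficientRatio m-1 b c) (mx : ℕ→ℚ (suc m-1) * x ≡ - 1ℚ)
  (Di : (x - 1ℚ) * x * (x + 1ℚ) * (x + ℕ→ℚ 2) * i ≡ 1ℚ) where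

  private
    m : ℕ
    m = suc m-1
    B : ℕ
    B = b ℕ.* (m ℕ.* m)

  sum-Gℤ : ∀ p → sumQ p (λ n → ℕ→ℚ n * G n x) ≡ sumQ p (λ n → (ℕ→ℚ n * ℤ→ℚ (Gℤ B c n)) ÷' ℕ→ℚ (B ℕ.^ n))
  sum-Gℤ p = sumQ-cong p (λ n _ → sym (÷'-unique (ℕ→ℚ≢0 (B ℕ.^ n) {{ℕP.m^n≢0 B n {{ℕP.m*n≢0 b (m ℕ.* m)}}}})
    (trans (eq (ℕ→ℚ (B ℕ.^ n)) (ℕ→ℚ n) (G n x)) (cong (ℕ→ℚ n *_) (Gℤ≡G {B} {c} {x} (binomQ-product m-1 b c c0 ratio mx) n)))))
    where
    eq : ∀ a b c → a * (b * c) ≡ b * (a * c)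
    eq = solve-∀ ℚ-ring

  -- Dividing m r + 1 = a p by m gives x = r + p y with y = -a/m, and a ≤ m forces r < p. Primes
  -- dividing the denominator of `i`, the inverse of t (t - 2), are the ones that must be kept out.
  congruence : ∀ {q} → Prime (suc q) → ¬ 2 ∣ suc q → ¬ suc q ∣ m → ¬ suc q ∣ ↧ₙ i → ∀ r a y v s →
    signQ r ≡ s → suc (m ℕ.* r) ≡ a ℕ.* suc q → a ≤ m → ℕ→ℚ m * y ≡ - ℕ→ℚ a →
    (x - 1ℚ) * x * (x + 1ℚ) * (x + ℕ→ℚ 2) * v ≡ (1ℚ - x * (x + 1ℚ)) * (1ℚ + y * (y + 1ℚ)) - s →
    CongQ (suc q) 3 (sumQ (suc q) (λ n → (ℕ→ℚ n * ℤ→ℚ (Gℤ B c n)) ÷' ℕ→ℚ (B ℕ.^ n))) (v * ℕ→ℚ (suc q ℕ.^ 2))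
  congruence {q} isPrime odd p∤m p∤i r a y v s r-sign mr+1 a≤m my Dv =
    subst₂ (CongQ p 3) (sum-Gℤ p) (ℚP.*-comm (ℕ→ℚ (p ℕ.^ 2)) v)
      (sum-nG-congruence y-integral r<p x≡ (InZp⇒Integral p∤i) Di (trans Dv (cong (λ s → (1ℚ - x * (x + 1ℚ)) * (1ℚ + y * (y + 1ℚ)) - s) (sym r-sign))))
    where
    open OddPrime isPrime odd
    open Congruence isPrime
    y-integral : Integral p y
    y-integral = /-integral p∤m (subst (Integral p) (sym my) (neg-integral (ℕ-integral a)))
    r<p : r < p
    r<p = ℕP.≰⇒> (λ p≤r → ℕP.<⇒≱ (ℕP.n<1+n (m ℕ.* r))
      (ℕP.≤-trans (ℕP.≤-reflexive mr+1) (ℕP.≤-trans (ℕP.*-monoˡ-≤ p a≤m) (ℕP.*-monoʳ-≤ m p≤r))))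
    eq₁ : ∀ z → - 1ℚ ≡ z - (z + 1ℚ)
    eq₁ = solve-∀ ℚ-ring
    eq₂ : ∀ m r a P → m * r - a * P ≡ m * r + P * - a
    eq₂ = solve-∀ ℚ-ring
    eq₃ : ∀ m r P y → m * r + P * (m * y) ≡ m * (r + P * y)
    eq₃ = solve-∀ ℚ-ring
    x≡ : x ≡ ℕ→ℚ r + P * y
    x≡ = *-cancelˡ (ℕ→ℚ≢0 m) (begin
      ℕ→ℚ m * x                              ≡⟨ mx ⟩
      - 1ℚ                                   ≡⟨ eq₁ (ℕ→ℚ (m ℕ.* r)) ⟩
      ℕ→ℚ (m ℕ.* r) - (ℕ→ℚ (m ℕ.* r) + 1ℚ)   ≡⟨ cong₂ _-_ (ℕ→ℚ-* m r) (trans (sym (ℕ→ℚ-suc (m ℕ.* r))) (trans (cong ℕ→ℚ mr+1) (ℕ→ℚ-* a p))) ⟩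
      ℕ→ℚ m * ℕ→ℚ r - ℕ→ℚ a * P              ≡⟨ eq₂ (ℕ→ℚ m) (ℕ→ℚ r) (ℕ→ℚ a) P ⟩
      ℕ→ℚ m * ℕ→ℚ r + P * - ℕ→ℚ a            ≡⟨ cong (λ z → ℕ→ℚ m * ℕ→ℚ r + P * z) my ⟨
      ℕ→ℚ m * ℕ→ℚ r + P * (ℕ→ℚ m * y)        ≡⟨ eq₃ (ℕ→ℚ m) (ℕ→ℚ r) P y ⟩
      ℕ→ℚ m * (ℕ→ℚ r + P * y)                ∎)

-- The fifth argument inverts t (t - 2), which takes the values 9/16, 40/81, 105/256 and 385/1296;
-- the primes of these numerators give the exceptions 5, 7 and 11.
module x=-1/2 = SpecialValue 1 4  c₂ (-[1+ 0 ] // 2) (+ 16 // 9)     refl ratio₂ refl refl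
module x=-1/3 = SpecialValue 2 3  c₃ (-[1+ 0 ] // 3) (+ 81 // 40)    refl ratio₃ refl refl
module x=-1/4 = SpecialValue 3 4  c₄ (-[1+ 0 ] // 4) (+ 256 // 105)  refl ratio₄ refl refl
module x=-1/6 = SpecialValue 5 12 c₆ (-[1+ 0 ] // 6) (+ 1296 // 385) refl ratio₆ refl refl

-- (x - 1) x (x + 1) (x + 2) = 385/1296 at x = -1/6, so the general congruence does not cover p = 5.
G6-congruence-5 : CongQ 5 3 (sumQ 5 (λ n → (ℕ→ℚ n * ℤ→ℚ (G6 n)) ÷' ℕ→ℚ (432 ℕ.^ n))) ((-[1+ 4 ] // 77) * ℕ→ℚ (5 ℕ.^ 2))
G6-congruence-5 = toWitnessFalse {a? = 5 ∣? _} _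

-- The general congruence, with the parity of r left in the sign

sum-nG-general : ∀ {q} → Prime (suc q) → ¬ 2 ∣ suc q → ∀ x → InZp (suc q) x →
  ¬ CongQ (suc q) 1 ((x - 1ℚ) * x * (x + 1ℚ) * (x + ℕ→ℚ 2)) 0ℚ →
  ∀ r → r < suc q → CongQ (suc q) 1 x (ℕ→ℚ r) → ∀ N →
  (let y = (x - ℕ→ℚ r) ÷' ℕ→ℚ (suc q) in N ≡ (1ℚ - x * (x + 1ℚ)) * (1ℚ + y * (y + 1ℚ)) - signQ r) →
  CongQ (suc q) 3 (sumQ (suc q) (λ n → ℕ→ℚ n * G n x)) (ℕ→ℚ (suc q ℕ.^ 2) * (N ÷' ((x - 1ℚ) * x * (x + 1ℚ) * (x + ℕ→ℚ 2))))
sum-nG-general {q} isPrime odd x x∈Zp D≢0 r r<p x≈r N N≡ =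
  let i , i-integral , Di = unit-inverse D-integral D≢0 in
  sum-nG-congruence y-integral r<p x≡ i-integral Di (trans (÷'-cancelˡ N (unit≢0 {D} {i} Di)) N≡)
  where
  open OddPrime isPrime odd using (p; sum-nG-congruence)
  open Congruence isPrime
  D : ℚ
  D = (x - 1ℚ) * x * (x + 1ℚ) * (x + ℕ→ℚ 2)
  y : ℚ
  y = (x - ℕ→ℚ r) ÷' P
  x-integral : Integral p x
  x-integral = InZp⇒Integral x∈Zp
  D-integral : Integral p D
  D-integral = *-integral (*-integral (*-integral (sub-integral x-integral (ℕ-integral 1)) x-integral)
    (+-integral x-integral (ℕ-integral 1))) (+-integral x-integral (ℕ-integral 2))
  y-integral : Integral p y
  y-integral = InZp⇒Integral (subst (λ n → InZp p ((x - ℕ→ℚ r) ÷' ℕ→ℚ n)) (ℕP.*-identityʳ p) x≈r)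
  eq : ∀ x r → x ≡ r + (x - r)
  eq = solve-∀ ℚ-ring
  x≡ : x ≡ ℕ→ℚ r + P * y
  x≡ = trans (eq x (ℕ→ℚ r)) (cong (_+_ (ℕ→ℚ r)) (sym (÷'-cancelˡ (x - ℕ→ℚ r) P≢0)))

-- Primes p > 3 by residue class

module PrimeAbove3 {q : ℕ} (isPrime : Prime (suc q)) (3<p : 3 < suc q) where

  open Congruence isPrime

  p : ℕ
  p = suc q

  ∤-prime : ∀ n {n-prime : True (prime? n)} → p ≢ n → ¬ p ∣ n
  ∤-prime n {n-prime} p≢n p∣n with prime⇒irreducible (toWitness n-prime) p∣n
  ... | inj₁ refl = contradiction 3<p λ { (ℕ.s≤s ()) }
  ... | inj₂ p≡n  = p≢n p≡n

  ∤p : ∀ n → 1 < n → n ≤ 3 → ¬ n ∣ p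
  ∤p n 1<n n≤3 n∣p with prime⇒irreducible isPrime n∣p
  ... | inj₁ refl = ℕP.<-irrefl refl 1<n
  ... | inj₂ refl = ℕP.<⇒≱ 3<p n≤3

  odd : ¬ 2 ∣ p
  odd = ∤p 2 (ℕ.s≤s (ℕ.s≤s ℕ.z≤n)) (ℕ.s≤s (ℕ.s≤s ℕ.z≤n))

  3∤p : ¬ 3 ∣ p
  3∤p = ∤p 3 (ℕ.s≤s (ℕ.s≤s ℕ.z≤n)) ℕP.≤-refl

  p∤2 : ¬ p ∣ 2
  p∤2 = ∤-< (ℕP.<-trans (ℕP.n<1+n 2) 3<p)

  p∤3 : ¬ p ∣ 3
  p∤3 = ∤-< 3<p

  -- Discards the exceptional primes lying outside the residue class at hand, for instance 5 when p
  -- ≡ 1 modulo 3, or 7 and 11 when p ≡ 1 modulo 4.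
  p≢ : ∀ d n .{{_ : ℕ.NonZero d}} {e} → p % d ≡ e → n % d ≢ e → p ≢ n
  p≢ d n p%d n%d refl = n%d p%d

  residue : ∀ d e .{{_ : ℕ.NonZero d}} → p % d ≡ e → ∃[ j ] p ≡ e ℕ.+ j ℕ.* d
  residue d e p%d≡e = p ℕ./ d , trans (m≡m%n+[m/n]*n p d) (cong (ℕ._+ p ℕ./ d ℕ.* d) p%d≡e)

  Sum : ℕ → (ℕ → ℤ) → ℚ
  Sum B H = sumQ p (λ n → (ℕ→ℚ n * ℤ→ℚ (H n)) ÷' ℕ→ℚ (B ℕ.^ n))

  p² : ℚ
  p² = ℕ→ℚ (p ℕ.^ 2)

  odd-sign : ∀ j → signQ (suc (j ℕ.* 2)) ≡ - 1ℚ
  odd-sign j = cong -_ (signQ-even j)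

  -- Here and in the other cases r = (a p - 1)/m is written as an explicit double or its successor,
  -- so that its sign is immediate.
  S2-1 : p % 4 ≡ 1 → CongQ p 3 (Sum 16 G2) ((-[1+ 0 ] // 9) * p²)
  S2-1 p%4 =
    let j , p≡ = residue 4 1 p%4 in
    x=-1/2.congruence isPrime odd p∤2 (∤-* p∤3 p∤3) (j ℕ.* 2) 1 (-[1+ 0 ] // 2) (-[1+ 0 ] // 9) 1ℚ
      (signQ-even j) (trans (eq j) (cong (1 ℕ.*_) (sym p≡))) (ℕ.s≤s ℕ.z≤n) refl refl
    where
    eq : ∀ j → suc (2 ℕ.* (j ℕ.* 2)) ≡ 1 ℕ.* (1 ℕ.+ j ℕ.* 4)
    eq = ℕSolver.solve-∀

  S2-3 : p % 4 ≡ 3 → CongQ p 3 (Sum 16 G2) ((+ 31 // 9) * p²)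
  S2-3 p%4 =
    let j , p≡ = residue 4 3 p%4 in
    x=-1/2.congruence isPrime odd p∤2 (∤-* p∤3 p∤3) (suc (j ℕ.* 2)) 1 (-[1+ 0 ] // 2) (+ 31 // 9) (- 1ℚ)
      (odd-sign j) (trans (eq j) (cong (1 ℕ.*_) (sym p≡))) (ℕ.s≤s ℕ.z≤n) refl refl
    where
    eq : ∀ j → suc (2 ℕ.* suc (j ℕ.* 2)) ≡ 1 ℕ.* (3 ℕ.+ j ℕ.* 4)
    eq = ℕSolver.solve-∀

  p∤40 : p ≢ 5 → ¬ p ∣ 40
  p∤40 p≢5 = ∤-* (∤-* p∤2 (∤-* p∤2 p∤2)) (∤-prime 5 p≢5)

  -- The parity of r = (p-1)/3 is not visible modulo 3. As p is odd, j is even and p = 6l + 1, so r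
  -- = 2l.
  S3-1 : p % 3 ≡ 1 → CongQ p 3 (Sum 27 G3) ((-[1+ 0 ] // 10) * p²)
  S3-1 p%3 = let j , p≡ = residue 3 1 p%3 in go j p≡ (even⊎odd j)
    where
    eq : ∀ l → suc (3 ℕ.* (l ℕ.* 2)) ≡ 1 ℕ.* (1 ℕ.+ l ℕ.* 2 ℕ.* 3)
    eq = ℕSolver.solve-∀
    eq′ : ∀ l → 1 ℕ.+ suc (l ℕ.* 2) ℕ.* 3 ≡ (2 ℕ.+ l ℕ.* 3) ℕ.* 2
    eq′ = ℕSolver.solve-∀
    go : ∀ j → p ≡ 1 ℕ.+ j ℕ.* 3 → (∃[ l ] j ≡ l ℕ.* 2) ⊎ (∃[ l ] j ≡ suc (l ℕ.* 2)) → CongQ p 3 (Sum 27 G3) ((-[1+ 0 ] // 10) * p²)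
    go _ p≡ (inj₁ (l , refl)) = x=-1/3.congruence isPrime odd p∤3 (p∤40 (p≢ 3 5 p%3 λ ())) (l ℕ.* 2) 1 (-[1+ 0 ] // 3) (-[1+ 0 ] // 10) 1ℚ
      (signQ-even l) (trans (eq l) (cong (1 ℕ.*_) (sym p≡))) (ℕ.s≤s ℕ.z≤n) refl refl
    go _ p≡ (inj₂ (l , refl)) = contradiction (divides (2 ℕ.+ l ℕ.* 3) (trans p≡ (eq′ l))) odd

  -- Oddness makes p = 6l + 5; with a = 2 this gives the odd number r = (2p-1)/3 = 4l + 3.
  S3-2 : p % 3 ≡ 2 → p ≢ 5 → CongQ p 3 (Sum 27 G3) ((+ 79 // 20) * p²)
  S3-2 p%3 p≢5 = let j , p≡ = residue 3 2 p%3 in go j p≡ (even⊎odd j)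
    where
    eq : ∀ l → suc (3 ℕ.* suc ((1 ℕ.+ l ℕ.* 2) ℕ.* 2)) ≡ 2 ℕ.* (2 ℕ.+ suc (l ℕ.* 2) ℕ.* 3)
    eq = ℕSolver.solve-∀
    eq′ : ∀ l → 2 ℕ.+ l ℕ.* 2 ℕ.* 3 ≡ (1 ℕ.+ l ℕ.* 3) ℕ.* 2
    eq′ = ℕSolver.solve-∀
    go : ∀ j → p ≡ 2 ℕ.+ j ℕ.* 3 → (∃[ l ] j ≡ l ℕ.* 2) ⊎ (∃[ l ] j ≡ suc (l ℕ.* 2)) → CongQ p 3 (Sum 27 G3) ((+ 79 // 20) * p²)
    go _ p≡ (inj₁ (l , refl)) = contradiction (divides (1 ℕ.+ l ℕ.* 3) (trans p≡ (eq′ l))) odd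
    go _ p≡ (inj₂ (l , refl)) = x=-1/3.congruence isPrime odd p∤3 (p∤40 p≢5) (suc ((1 ℕ.+ l ℕ.* 2) ℕ.* 2)) 2 (-[1+ 1 ] // 3) (+ 79 // 20) (- 1ℚ)
      (odd-sign (1 ℕ.+ l ℕ.* 2)) (trans (eq l) (cong (2 ℕ.*_) (sym p≡))) (ℕ.s≤s (ℕ.s≤s ℕ.z≤n)) refl refl

  p∤4 : ¬ p ∣ 4
  p∤4 = ∤-* p∤2 p∤2

  p∤105 : p ≢ 5 → p ≢ 7 → ¬ p ∣ 105
  p∤105 p≢5 p≢7 = ∤-* p∤3 (∤-* (∤-prime 5 p≢5) (∤-prime 7 p≢7))

  S4-13 : p % 8 ≡ 1 ⊎ p % 8 ≡ 3 → CongQ p 3 (Sum 64 G4) ((-[1+ 2 ] // 35) * p²)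
  S4-13 (inj₁ p%8) =
    let j , p≡ = residue 8 1 p%8 in
    x=-1/4.congruence isPrime odd p∤4 (p∤105 (p≢ 8 5 p%8 λ ()) (p≢ 8 7 p%8 λ ()))
      (j ℕ.* 2) 1 (-[1+ 0 ] // 4) (-[1+ 2 ] // 35) 1ℚ
      (signQ-even j) (trans (eq j) (cong (1 ℕ.*_) (sym p≡))) (ℕ.s≤s ℕ.z≤n) refl refl
    where
    eq : ∀ j → suc (4 ℕ.* (j ℕ.* 2)) ≡ 1 ℕ.* (1 ℕ.+ j ℕ.* 8)
    eq = ℕSolver.solve-∀
  S4-13 (inj₂ p%8) =
    let j , p≡ = residue 8 3 p%8 in
    x=-1/4.congruence isPrime odd p∤4 (p∤105 (p≢ 8 5 p%8 λ ()) (p≢ 8 7 p%8 λ ()))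
      -- a p ≡ 1 modulo 4 forces a = 3, hence r = (3p-1)/4 = 6j + 2.
      ((1 ℕ.+ j ℕ.* 3) ℕ.* 2) 3 (-[1+ 2 ] // 4) (-[1+ 2 ] // 35) 1ℚ
      (signQ-even (1 ℕ.+ j ℕ.* 3)) (trans (eq j) (cong (3 ℕ.*_) (sym p≡))) (ℕ.s≤s (ℕ.s≤s (ℕ.s≤s ℕ.z≤n))) refl refl
    where
    eq : ∀ j → suc (4 ℕ.* ((1 ℕ.+ j ℕ.* 3) ℕ.* 2)) ≡ 3 ℕ.* (3 ℕ.+ j ℕ.* 8)
    eq = ℕSolver.solve-∀

  S4-57 : p % 8 ≡ 5 ⊎ p % 8 ≡ 7 → p ≢ 5 → p ≢ 7 → CongQ p 3 (Sum 64 G4) ((+ 503 // 105) * p²)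
  S4-57 (inj₁ p%8) p≢5 p≢7 =
    let j , p≡ = residue 8 5 p%8 in
    x=-1/4.congruence isPrime odd p∤4 (p∤105 p≢5 p≢7) (suc (j ℕ.* 2)) 1 (-[1+ 0 ] // 4) (+ 503 // 105) (- 1ℚ)
      (odd-sign j) (trans (eq j) (cong (1 ℕ.*_) (sym p≡))) (ℕ.s≤s ℕ.z≤n) refl refl
    where
    eq : ∀ j → suc (4 ℕ.* suc (j ℕ.* 2)) ≡ 1 ℕ.* (5 ℕ.+ j ℕ.* 8)
    eq = ℕSolver.solve-∀
  S4-57 (inj₂ p%8) p≢5 p≢7 =
    let j , p≡ = residue 8 7 p%8 in
    x=-1/4.congruence isPrime odd p∤4 (p∤105 p≢5 p≢7) (suc ((2 ℕ.+ j ℕ.* 3) ℕ.* 2)) 3 (-[1+ 2 ] // 4) (+ 503 // 105) (- 1ℚ)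
      (odd-sign (2 ℕ.+ j ℕ.* 3)) (trans (eq j) (cong (3 ℕ.*_) (sym p≡))) (ℕ.s≤s (ℕ.s≤s (ℕ.s≤s ℕ.z≤n))) refl refl
    where
    eq : ∀ j → suc (4 ℕ.* suc ((2 ℕ.+ j ℕ.* 3) ℕ.* 2)) ≡ 3 ℕ.* (7 ℕ.+ j ℕ.* 8)
    eq = ℕSolver.solve-∀

  p∤6 : ¬ p ∣ 6
  p∤6 = ∤-* p∤2 p∤3

  p∤385 : p ≢ 5 → p ≢ 7 → p ≢ 11 → ¬ p ∣ 385
  p∤385 p≢5 p≢7 p≢11 = ∤-* (∤-prime 5 p≢5) (∤-* (∤-prime 7 p≢7) (∤-prime 11 p≢11))

  -- The multiplier a depends on p modulo 6 and the parity of r on p modulo 12. Splitting j modulo 3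
  -- yields p ≡ 1 with a = 1, p ≡ 5 with a = 5, and p ≡ 9, which is divisible by 3; r is even in the
  -- first two classes.
  S6-1-≢5 : p % 4 ≡ 1 → p ≢ 5 → CongQ p 3 (Sum 432 G6) ((-[1+ 4 ] // 77) * p²)
  S6-1-≢5 p%4 p≢5 = let j , p≡ = residue 4 1 p%4 in go j p≡ (j divMod 3)
    where
    p∤i : ¬ p ∣ 385
    p∤i = p∤385 p≢5 (p≢ 4 7 p%4 λ ()) (p≢ 4 11 p%4 λ ())
    eq₀ : ∀ l → suc (6 ℕ.* (l ℕ.* 2)) ≡ 1 ℕ.* (1 ℕ.+ l ℕ.* 3 ℕ.* 4)
    eq₀ = ℕSolver.solve-∀
    eq₁ : ∀ l → suc (6 ℕ.* ((2 ℕ.+ l ℕ.* 5) ℕ.* 2)) ≡ 5 ℕ.* (1 ℕ.+ suc (l ℕ.* 3) ℕ.* 4)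
    eq₁ = ℕSolver.solve-∀
    eq₂ : ∀ l → 1 ℕ.+ suc (suc (l ℕ.* 3)) ℕ.* 4 ≡ (3 ℕ.+ l ℕ.* 4) ℕ.* 3
    eq₂ = ℕSolver.solve-∀
    go : ∀ j → p ≡ 1 ℕ.+ j ℕ.* 4 → DivMod j 3 → CongQ p 3 (Sum 432 G6) ((-[1+ 4 ] // 77) * p²)
    go _ p≡ (result l fzero refl) = x=-1/6.congruence isPrime odd p∤6 p∤i (l ℕ.* 2) 1 (-[1+ 0 ] // 6) (-[1+ 4 ] // 77) 1ℚ
      (signQ-even l) (trans (eq₀ l) (cong (1 ℕ.*_) (sym p≡))) (ℕ.s≤s ℕ.z≤n) refl refl
    go _ p≡ (result l (fsuc fzero) refl) = x=-1/6.congruence isPrime odd p∤6 p∤i ((2 ℕ.+ l ℕ.* 5) ℕ.* 2) 5 (-[1+ 4 ] // 6) (-[1+ 4 ] // 77) 1ℚ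
      (signQ-even (2 ℕ.+ l ℕ.* 5)) (trans (eq₁ l) (cong (5 ℕ.*_) (sym p≡))) (ℕP.n≤1+n 5) refl refl
    go _ p≡ (result l (fsuc (fsuc fzero)) refl) = contradiction (divides (3 ℕ.+ l ℕ.* 4) (trans p≡ (eq₂ l))) 3∤p

  S6-1 : p % 4 ≡ 1 → CongQ p 3 (Sum 432 G6) ((-[1+ 4 ] // 77) * p²)
  S6-1 p%4 = cases (p ℕP.≟ 5)
    where
    cases : Dec (p ≡ 5) → CongQ p 3 (Sum 432 G6) ((-[1+ 4 ] // 77) * p²)
    cases (yes p≡5) = subst (λ p → CongQ p 3 (sumQ p (λ n → (ℕ→ℚ n * ℤ→ℚ (G6 n)) ÷' ℕ→ℚ (432 ℕ.^ n))) ((-[1+ 4 ] // 77) * ℕ→ℚ (p ℕ.^ 2)))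
      (sym p≡5) G6-congruence-5
    cases (no p≢5)  = S6-1-≢5 p%4 p≢5

  -- Modulo 12 the classes are 3, divisible by 3, then 7 with a = 1 and 11 with a = 5; r is odd in
  -- the last two.
  S6-3 : p % 4 ≡ 3 → p ≢ 7 → p ≢ 11 → CongQ p 3 (Sum 432 G6) ((+ 2567 // 385) * p²)
  S6-3 p%4 p≢7 p≢11 = let j , p≡ = residue 4 3 p%4 in go j p≡ (j divMod 3)
    where
    p∤i : ¬ p ∣ 385
    p∤i = p∤385 (p≢ 4 5 p%4 λ ()) p≢7 p≢11
    eq₀ : ∀ l → 3 ℕ.+ l ℕ.* 3 ℕ.* 4 ≡ (1 ℕ.+ l ℕ.* 4) ℕ.* 3
    eq₀ = ℕSolver.solve-∀
    eq₁ : ∀ l → suc (6 ℕ.* suc (l ℕ.* 2)) ≡ 1 ℕ.* (3 ℕ.+ suc (l ℕ.* 3) ℕ.* 4)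
    eq₁ = ℕSolver.solve-∀
    eq₂ : ∀ l → suc (6 ℕ.* suc ((4 ℕ.+ l ℕ.* 5) ℕ.* 2)) ≡ 5 ℕ.* (3 ℕ.+ suc (suc (l ℕ.* 3)) ℕ.* 4)
    eq₂ = ℕSolver.solve-∀
    go : ∀ j → p ≡ 3 ℕ.+ j ℕ.* 4 → DivMod j 3 → CongQ p 3 (Sum 432 G6) ((+ 2567 // 385) * p²)
    go _ p≡ (result l fzero refl) = contradiction (divides (1 ℕ.+ l ℕ.* 4) (trans p≡ (eq₀ l))) 3∤p
    go _ p≡ (result l (fsuc fzero) refl) = x=-1/6.congruence isPrime odd p∤6 p∤i (suc (l ℕ.* 2)) 1 (-[1+ 0 ] // 6) (+ 2567 // 385) (- 1ℚ)
      (odd-sign l) (trans (eq₁ l) (cong (1 ℕ.*_) (sym p≡))) (ℕ.s≤s ℕ.z≤n) refl refl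
    go _ p≡ (result l (fsuc (fsuc fzero)) refl) = x=-1/6.congruence isPrime odd p∤6 p∤i (suc ((4 ℕ.+ l ℕ.* 5) ℕ.* 2)) 5 (-[1+ 4 ] // 6) (+ 2567 // 385) (- 1ℚ)
      (odd-sign (4 ℕ.+ l ℕ.* 5)) (trans (eq₂ l) (cong (5 ℕ.*_) (sym p≡))) (ℕP.n≤1+n 5) refl refl

-- The two parities of r and the full theorem

sum-nG-even : ∀ {q} → Prime (suc q) → ¬ 2 ∣ suc q → ∀ x → InZp (suc q) x →
  ¬ CongQ (suc q) 1 ((x - 1ℚ) * x * (x + 1ℚ) * (x + ℕ→ℚ 2)) 0ℚ → ∀ r → r < suc q → CongQ (suc q) 1 x (ℕ→ℚ r) →
  let y = (x - ℕ→ℚ r) ÷' ℕ→ℚ (suc q) in 2 ∣ r →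
  CongQ (suc q) 3 (sumQ (suc q) (λ n → ℕ→ℚ n * G n x))
    (ℕ→ℚ (suc q ℕ.^ 2) * ((y * (y + 1ℚ) * (1ℚ - x * (x + 1ℚ)) - x * (x + 1ℚ)) ÷' ((x - 1ℚ) * x * (x + 1ℚ) * (x + ℕ→ℚ 2))))
sum-nG-even {q} isPrime odd x x∈Zp D≢0 r r<p x≈r 2∣r = sum-nG-general isPrime odd x x∈Zp D≢0 r r<p x≈r _
  (trans (eq x y) (cong (λ s → (1ℚ - x * (x + 1ℚ)) * (1ℚ + y * (y + 1ℚ)) - s) (sym (signQ-2∣ 2∣r))))
  where
  y = (x - ℕ→ℚ r) ÷' ℕ→ℚ (suc q)
  eq : ∀ x y → y * (y + 1ℚ) * (1ℚ - x * (x + 1ℚ)) - x * (x + 1ℚ) ≡ (1ℚ - x * (x + 1ℚ)) * (1ℚ + y * (y + 1ℚ)) - 1ℚ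
  eq = solve-∀ ℚ-ring

-- Subtracting (-1)^r = -1 from (1-t)(1+x'(x'+1)) leaves x'(x'+1)(1-t) - (t-2), and t - 2 =
-- (x-1)(x+2); for even r the remainder is -t instead.
sum-nG-odd : ∀ {q} → Prime (suc q) → ¬ 2 ∣ suc q → ∀ x → InZp (suc q) x →
  ¬ CongQ (suc q) 1 ((x - 1ℚ) * x * (x + 1ℚ) * (x + ℕ→ℚ 2)) 0ℚ → ∀ r → r < suc q → CongQ (suc q) 1 x (ℕ→ℚ r) →
  let y = (x - ℕ→ℚ r) ÷' ℕ→ℚ (suc q) in ¬ 2 ∣ r →
  CongQ (suc q) 3 (sumQ (suc q) (λ n → ℕ→ℚ n * G n x))
    (ℕ→ℚ (suc q ℕ.^ 2) * ((y * (y + 1ℚ) * (1ℚ - x * (x + 1ℚ)) - (x - 1ℚ) * (x + ℕ→ℚ 2)) ÷' ((x - 1ℚ) * x * (x + 1ℚ) * (x + ℕ→ℚ 2))))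
sum-nG-odd {q} isPrime odd x x∈Zp D≢0 r r<p x≈r 2∤r = sum-nG-general isPrime odd x x∈Zp D≢0 r r<p x≈r _
  (trans (eq x y) (cong (λ s → (1ℚ - x * (x + 1ℚ)) * (1ℚ + y * (y + 1ℚ)) - s) (sym (signQ-2∤ 2∤r))))
  where
  y = (x - ℕ→ℚ r) ÷' ℕ→ℚ (suc q)
  eq : ∀ x y → y * (y + 1ℚ) * (1ℚ - x * (x + 1ℚ)) - (x - 1ℚ) * (x + (1ℚ + 1ℚ)) ≡ (1ℚ - x * (x + 1ℚ)) * (1ℚ + y * (y + 1ℚ)) - - 1ℚ
  eq = solve-∀ ℚ-ring

theorem3p3 :
  ((p : ℕ) → Prime p → ¬ (2 ∣ p) → (x : ℚ) → InZp p x →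
    ¬ CongQ p 1 ((x - 1ℚ) * x * (x + 1ℚ) * (x + ℕ→ℚ 2)) 0ℚ →
    (r : ℕ) → r < p → CongQ p 1 x (ℕ→ℚ r) →
    let x' = (x - ℕ→ℚ r) ÷' ℕ→ℚ p
        D = (x - 1ℚ) * x * (x + 1ℚ) * (x + ℕ→ℚ 2)
        S = sumQ p (λ n → ℕ→ℚ n * G n x)
    in (2 ∣ r → CongQ p 3 S (ℕ→ℚ (p ℕ.^ 2) * ((x' * (x' + 1ℚ) * (1ℚ - x * (x + 1ℚ)) - x * (x + 1ℚ)) ÷' D)))
     × (¬ (2 ∣ r) → CongQ p 3 S (ℕ→ℚ (p ℕ.^ 2) * ((x' * (x' + 1ℚ) * (1ℚ - x * (x + 1ℚ)) - (x - 1ℚ) * (x + ℕ→ℚ 2)) ÷' D))))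
  ×
  ((p : ℕ) → Prime p → 3 < p →
    let S2 = sumQ p (λ n → (ℕ→ℚ n * ℤ→ℚ (G2 n)) ÷' ℕ→ℚ (16 ℕ.^ n))
        S3 = sumQ p (λ n → (ℕ→ℚ n * ℤ→ℚ (G3 n)) ÷' ℕ→ℚ (27 ℕ.^ n))
        S4 = sumQ p (λ n → (ℕ→ℚ n * ℤ→ℚ (G4 n)) ÷' ℕ→ℚ (64 ℕ.^ n))
        S6 = sumQ p (λ n → (ℕ→ℚ n * ℤ→ℚ (G6 n)) ÷' ℕ→ℚ (432 ℕ.^ n))
        pp = ℕ→ℚ (p ℕ.^ 2)
    in (p % 4 ≡ 1 → CongQ p 3 S2 (((-[1+ 0 ]) // 9) * pp))
     × (p % 4 ≡ 3 → CongQ p 3 S2 ((+ 31 // 9) * pp))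
     × (p % 3 ≡ 1 → CongQ p 3 S3 (((-[1+ 0 ]) // 10) * pp))
     × (p % 3 ≡ 2 → p ≢ 5 → CongQ p 3 S3 ((+ 79 // 20) * pp))
     × ((p % 8 ≡ 1 ⊎ p % 8 ≡ 3) → CongQ p 3 S4 (((-[1+ 2 ]) // 35) * pp))
     × ((p % 8 ≡ 5 ⊎ p % 8 ≡ 7) → p ≢ 5 → p ≢ 7 → CongQ p 3 S4 ((+ 503 // 105) * pp))
     × (p % 4 ≡ 1 → CongQ p 3 S6 (((-[1+ 4 ]) // 77) * pp))
     × (p % 4 ≡ 3 → p ≢ 7 → p ≢ 11 → CongQ p 3 S6 ((+ 2567 // 385) * pp)))
theorem3p3 = general , special
  where
  general : _
  general zero    isPrime = contradiction isPrime ¬prime[0]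
  general (suc q) isPrime odd x x∈Zp D≢0 r r<p x≈r =
    sum-nG-even isPrime odd x x∈Zp D≢0 r r<p x≈r , sum-nG-odd isPrime odd x x∈Zp D≢0 r r<p x≈r
  special : _
  special zero    isPrime = contradiction isPrime ¬prime[0]
  special (suc q) isPrime 3<p = S2-1 , S2-3 , S3-1 , S3-2 , S4-13 , S4-57 , S6-1 , S6-3
    where
    open PrimeAbove3 isPrime 3<p
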